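{- Let $1\le l\le m\le n$ be integers and let $v=(v_1,\dots,v_l)\in[n]^l$ be strictly increasing. The number of parking functions $\pi\in \mathrm{PF}(m,n)$ with $\pi_1=v_1,\dots,\pi_l=v_l$ is $$(n-m+1)\sum_{s\in S_l(v)}\binom{m-l}{s}(s_1+1+n-m)^{s_1-1}\prod_{i=2}^{l+1}(s_i+1)^{s_i-1},$$ where $$S_l(v)=\Big\{s=(s_1,\dots,s_{l+1})\in\mathbb N^{l+1}:\ s_1+\cdots+s_i\ge m-n+v_i-i\ \ \forall i\in[l],\ \ s_1+\cdots+s_{l+1}=m-l\Big\}.$$ Moreover, this quantity takes the same value for all $v$ with $v_i\le n-m+i$ for all $i\in[l]$, and it decreases as any $v_i$ increases past $n-m+i$: if $v,v'\in[n]^l$ are strictly increasing, differ only in the $i$th coordinate, and $n-m+i\le v_i<v_i'$, then the number for $v'$ is smaller than the number for $v$.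
   Context: Write $[n]=\{1,\dots,n\}$ and $\mathbb N=\{0,1,2,\dots\}$. For integers $0\le m\le n$, $\mathrm{PF}(m,n)$ denotes the set of parking functions with $m$ cars and $n$ spots: sequences $(\pi_1,\dots,\pi_m)\in[n]^m$ such that, when cars $1,\dots,m$ enter in order a one-way street with spots $1,\dots,n$ and car $i$ parks in spot $\pi_i$ if it is free and otherwise in the first free spot after $\pi_i$, all cars park. Equivalently, the non-decreasing rearrangement $(\lambda_1,\dots,\lambda_m)$ satisfies $\lambda_i\le n-m+i$ for all $i$. For $s=(s_1,\dots,s_{l+1})$ with sum $m-l$, $\binom{m-l}{s}=\frac{(m-l)!}{s_1!\cdots s_{l+1}!}$. Powers with exponent $-1$ are taken in $\mathbb Q$. -}

module Defs where

open import Data.Fin as Fin using (Fin; toℕ; inject≤)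
open import Data.Fin.Properties as Fin using (all?)
open import Data.Fin.Subset using (Subset; _∪_; ⁅_⁆) renaming (⊥ to ∅)
open import Data.Fin.Subset.Properties using (_∈?_)
open import Data.Integer as ℤ using (ℤ; +_; -[1+_]; 1ℤ)
import Data.Integer.Properties as ℤ
open import Data.List as List using (List; allFin; upTo; filter; find; length; cartesianProductWith)
open import Data.List.Relation.Unary.All using (universal)
open import Data.List.Relation.Unary.All.Properties using (map⁺)
open import Data.Maybe using (Maybe; just; Is-just; _>>=_)
open import Data.Maybe.Relation.Unary.Any as Maybe using ()
open import Data.Nat as ℕ using (ℕ; zero; suc; _+_; _∸_; _^_; _≤_; _!; NonZero)
open import Data.Nat.ListAction using (sum; product)
open import Data.Nat.ListAction.Properties using (product≢0)
open import Data.Nat.Properties as ℕ using (_!≢0; m^n≢0)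
open import Data.Product using (_×_)
open import Data.Rational as ℚ using (ℚ; 0ℚ; 1ℚ)
open import Data.Unit using (tt)
open import Data.Vec as Vec using (Vec; []; _∷_; lookup; toList)
open import Relation.Binary using (_Preserves_⟶_)
open import Relation.Binary.PropositionalEquality using (_≡_)
open import Relation.Nullary using (yes; ¬?; _×-dec_)
open import Relation.Unary using (Decidable)

-- The set [n] = {1,…,n} is represented by Fin n, with x : Fin n standing for
-- the number num x.
num : ∀ {n} → Fin n → ℕ
num x = suc (toℕ x)

words : ∀ {A : Set} k → List A → List (Vec A k)
words zero    xs = [] List.∷ List.[]
words (suc k) xs = cartesianProductWith _∷_ xs (words k xs)

-- allFin n is increasing, so find returns the first spot at or after p
-- that is not in the set of occupied spots.
firstFree : ∀ {n} → Subset n → Fin n → Maybe (Fin n)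
firstFree {n} occupied p =
  find (λ q → (p Fin.≤? q) ×-dec ¬? (q ∈? occupied)) (allFin n)

-- The set of occupied spots once all cars have parked, or nothing if some
-- car finds no free spot.
park : ∀ {m n} → Subset n → Vec (Fin n) m → Maybe (Subset n)
park occupied []      = just occupied
park occupied (p ∷ π) = firstFree occupied p >>= λ q → park (occupied ∪ ⁅ q ⁆) π

IsParkingFunction : ∀ {m n} → Vec (Fin n) m → Set
IsParkingFunction π = Is-just (park ∅ π)

isParkingFunction? : ∀ {m n} → Decidable (IsParkingFunction {m} {n})
isParkingFunction? π = Maybe.dec (λ _ → yes tt) (park ∅ π)

PF : ∀ m n → List (Vec (Fin n) m)
PF m n = filter isParkingFunction? (words m (allFin n))

StartsWith : ∀ {l m n} → l ≤ m → Vec (Fin n) l → Vec (Fin n) m → Set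
StartsWith l≤m v π = ∀ i → lookup π (inject≤ i l≤m) ≡ lookup v i

startsWith? : ∀ {l m n} (l≤m : l ≤ m) (v : Vec (Fin n) l) → Decidable (StartsWith l≤m v)
startsWith? l≤m v π = all? λ i → lookup π (inject≤ i l≤m) Fin.≟ lookup v i

#PF : ∀ {l m n} → l ≤ m → Vec (Fin n) l → ℕ
#PF {m = m} {n} l≤m v = length (filter (startsWith? l≤m v) (PF m n))

StrictlyIncreasing : ∀ {l n} → Vec (Fin n) l → Set
StrictlyIncreasing v = lookup v Preserves Fin._<_ ⟶ Fin._<_

-- partialSum i s = s₁ + ⋯ + sᵢ
partialSum : ∀ {k} → ℕ → Vec ℕ k → ℕ
partialSum i s = sum (List.take i (toList s))

-- The defining conditions of S_l(v); the lower bound may be negative, so it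
-- is taken in ℤ.
InS : ∀ {l n} → ℕ → Vec (Fin n) l → Vec ℕ (suc l) → Set
InS {l} {n} m v s =
  (∀ (i : Fin l) →
     + m ℤ.- + n ℤ.+ + num (lookup v i) ℤ.- + num i ℤ.≤ + partialSum (num i) s)
  × Vec.sum s ≡ m ∸ l

inS? : ∀ {l n} m (v : Vec (Fin n) l) → Decidable (InS m v)
inS? {l} {n} m v s =
  (all? λ i → (+ m ℤ.- + n ℤ.+ + num (lookup v i) ℤ.- + num i) ℤ.≤? + partialSum (num i) s)
  ×-dec (Vec.sum s ℕ.≟ m ∸ l)

-- Entries summing to m ∸ l are at most m ∸ l, so restricting the enumeration
-- to vectors with entries in {0,…,m ∸ l} loses nothing.
S : ∀ {l n} → ℕ → Vec (Fin n) l → List (Vec ℕ (suc l))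
S {l} m v = filter (inS? m v) (words (suc l) (upTo (suc (m ∸ l))))

fromℕ : ℕ → ℚ
fromℕ a = + a ℚ./ 1

infixr 8 _^ℤ_
_^ℤ_ : (a : ℕ) .{{_ : NonZero a}} → ℤ → ℚ
a ^ℤ (+ k)    = fromℕ (a ^ k)
a ^ℤ -[1+ k ] = ℚ._/_ 1ℤ (a ^ suc k) {{m^n≢0 a (suc k)}}

-- N! / (s₁! ⋯ sₖ!)
multinomial : ∀ {k} → ℕ → Vec ℕ k → ℚ
multinomial N s =
  ℚ._/_ (+ (N !)) (product (List.map _! (toList s)))
        {{product≢0 (map⁺ (universal _!≢0 (toList s)))}}

sumℚ productℚ : List ℚ → ℚ
sumℚ     = List.foldr ℚ._+_ 0ℚ
productℚ = List.foldr ℚ._*_ 1ℚ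

summand : ∀ {l} (m n : ℕ) → Vec ℕ (suc l) → ℚ
summand {l} m n s@(s₁ ∷ s′) =
  multinomial (m ∸ l) s
  ℚ.* suc (s₁ + (n ∸ m)) ^ℤ (+ s₁ ℤ.- 1ℤ)
  ℚ.* productℚ (List.map (λ sᵢ → suc sᵢ ^ℤ (+ sᵢ ℤ.- 1ℤ)) (toList s′))

abelSum : ∀ {l n} → ℕ → Vec (Fin n) l → ℚ
abelSum {n = n} m v =
  fromℕ (suc (n ∸ m)) ℚ.* sumℚ (List.map (summand m n) (S m v))

{-# OPTIONS --safe #-}
module Submission where

-- Park the last m − l cars first. They leave n − m + l spots free, and as v is
-- increasing, the cars 1,…,l then fit exactly if vᵢ ≤ fᵢ for all i, where
-- f₁ < ⋯ < f_l are the last l free spots. Cutting the street at these spots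
-- leaves blocks of s₁ + n − m, s₂, …, s_{l+1} spots that are filled by parking
-- functions with s₁, s₂, …, s_{l+1} cars, whence the formula.
--
-- The cut is made on the walk whose height before spot k is the number of spots
-- from k on, minus the number of the last m − l cars preferring them, plus one.
-- Reading the street from left to right the walk descends by at most one per
-- spot, fᵢ is the spot at which it first drops to height l − i + 1, and the
-- blocks are counted by the hitting time numbers a (a + s)^(s − 1); these obey
-- the first-step recurrence by the binomial theorem.
--
-- For the strict decrease at vᵢ, complete v by as many cars preferring vᵢ + 1 as
-- fit, and by cars preferring 1: this no longer parks once vᵢ has increased.

open import Defs
open import Algebra.Bundles using (CommutativeMonoid)
open import Data.Empty using (⊥-elim)
open import Data.Fin as Fin using (Fin; toℕ)
open import Data.Fin.Properties as Fin using (all?; toℕ<n; toℕ-inject₁; toℕ-fromℕ<)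
open import Data.Fin.Subset using (Subset; _∪_; ⁅_⁆; _∈_; _∉_) renaming (⊥ to ∅)
open import Data.Fin.Subset.Properties using (_∈?_; ∉⊥; x∈p∪q⁻; x∈p∪q⁺; x∈⁅x⁆; x∈⁅y⁆⇒x≡y)
open import Data.Integer as ℤ using (1ℤ) renaming (+_ to pos)
import Data.Integer.Properties as ℤ
import Data.Integer.Tactic.RingSolver as ℤ
open import Data.List as List using (List; []; _∷_; _++_; allFin; tabulate; find; filter; length; cartesianProductWith; replicate; upTo; applyUpTo)
open import Data.List.Properties using (length-++; length-replicate; map-++; map-∘; map-tabulate; map-upTo)
open import Data.List.Relation.Unary.All as ListAll using ([]; _∷_)
open import Data.List.Relation.Unary.All.Properties using (replicate⁺; ++⁺; map⁺)
open import Data.Maybe using (just; nothing; Is-just)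
open import Data.Maybe.Relation.Unary.Any using (just)
open import Data.Nat using (ℕ; zero; suc; _+_; _*_; _∸_; _^_; _!; _≤_; _<_; _≤?_; _<?_; _≟_; z≤n; s≤s; s≤s⁻¹; NonZero)
open import Data.Nat.Combinatorics using (_C_; nCk+nC[k+1]≡[n+1]C[k+1]; k>n⇒nCk≡0; k![n∸k]!∣n!; nCk≡n!/k![n-k]!)
open import Data.Nat.DivMod using (m/n*n≡m)
open import Data.Nat.ListAction using (sum; product)
open import Data.Nat.ListAction.Properties using (sum-++; product≢0)
open import Data.Nat.Properties
open import Data.Nat.Tactic.RingSolver using (solve-∀)
open import Data.Product using (_×_; _,_; proj₁; proj₂; ∃)
open import Data.Rational as ℚ using (ℚ; toℚᵘ)
import Data.Rational.Properties as ℚ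
open import Data.Rational.Unnormalised as ℚᵘ using (mkℚᵘ; *≡*)
import Data.Rational.Unnormalised.Properties as ℚᵘ
open import Data.Sum using (_⊎_; inj₁; inj₂)
open import Data.Unit using (tt)
open import Data.Vec as Vec using (Vec; []; _∷_; toList; lookup)
open import Data.Vec.Properties using (lookup-map; length-toList)
open import Data.Vec.Relation.Unary.All as All using (All; []; _∷_)
open import Data.Vec.Relation.Unary.All.Properties using (lookup⁻)
open import Data.Vec.Relation.Unary.AllPairs as AllPairs using (AllPairs; []; _∷_)
open import Function using (_∘_; id)
open import Relation.Binary.PropositionalEquality
open import Relation.Nullary using (Dec; yes; no; ¬_; ¬?; _×-dec_)
open import Relation.Unary using (Decidable)
open import Algebra.Properties.CommutativeSemigroup (CommutativeMonoid.commutativeSemigroup ℚ.*-1-commutativeMonoid) using () renaming (x∙yz≈y∙xz to ℚ-swap)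
open import Algebra.Properties.Semiring.Sum +-*-semiring using (∑-distrib-+; sum-cong-≗; sum-replicate-zero) renaming (sum to ∑)

-- Indicators and finite sums.

private variable
  P Q : Set

ind : Dec P → ℕ
ind (yes _) = 1
ind (no  _) = 0

ind-yes : (d : Dec P) → P → ind d ≡ 1
ind-yes (yes _) _ = refl
ind-yes (no ¬p) p = ⊥-elim (¬p p)

ind-no : (d : Dec P) → ¬ P → ind d ≡ 0
ind-no (yes p) ¬p = ⊥-elim (¬p p)
ind-no (no _)  _  = refl

ind-mono : (d : Dec P) (e : Dec Q) → (P → Q) → ind d ≤ ind e
ind-mono (no _)  e f = z≤n
ind-mono (yes p) e f = ≤-reflexive (sym (ind-yes e (f p)))

ind-cong : (d : Dec P) (e : Dec Q) → (P → Q) → (Q → P) → ind d ≡ ind e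
ind-cong d e f g = ≤-antisym (ind-mono d e f) (ind-mono e d g)

ind-× : (d : Dec P) (e : Dec Q) → ind (d ×-dec e) ≡ ind d * ind e
ind-× (yes _) (yes _) = refl
ind-× (yes _) (no _)  = refl
ind-× (no _)  _       = refl

∑-zero : ∀ {n} {f : Fin n → ℕ} → (∀ i → f i ≡ 0) → ∑ f ≡ 0
∑-zero {n} f≡0 = trans (sum-cong-≗ f≡0) (sum-replicate-zero n)

∑-delta : ∀ {n} (q : Fin n) (F : Fin n → ℕ) → ∑ (λ i → ind (i Fin.≟ q) * F i) ≡ F q
∑-delta {suc n} Fin.zero F = begin
  F Fin.zero + 0 + ∑ (λ i → ind (Fin.suc i Fin.≟ Fin.zero) * F (Fin.suc i))
    ≡⟨ cong₂ _+_ (+-identityʳ _) (∑-zero {n} λ i → refl) ⟩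
  F Fin.zero + 0
    ≡⟨ +-identityʳ _ ⟩
  F Fin.zero ∎
  where open ≡-Reasoning
∑-delta {suc n} (Fin.suc q) F = trans
  (sum-cong-≗ λ i → cong (_* F (Fin.suc i))
    (ind-cong (Fin.suc i Fin.≟ Fin.suc q) (i Fin.≟ q) (λ { refl → refl }) (cong Fin.suc)))
  (∑-delta q (F ∘ Fin.suc))

-- Binomial convolution.

-- conv M F = Σ_{c+d=M} (M choose c) F c d, by Pascal's rule.
conv : ℕ → (ℕ → ℕ → ℕ) → ℕ
conv zero    F = F 0 0
conv (suc M) F = conv M (λ c d → F (suc c) d) + conv M (λ c d → F c (suc d))

conv-cong : ∀ M {F G} → (∀ c d → c + d ≡ M → F c d ≡ G c d) → conv M F ≡ conv M G
conv-cong zero    F≡G = F≡G 0 0 refl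
conv-cong (suc M) F≡G = cong₂ _+_
  (conv-cong M λ c d c+d≡M → F≡G (suc c) d (cong suc c+d≡M))
  (conv-cong M λ c d c+d≡M → F≡G c (suc d) (trans (+-suc c d) (cong suc c+d≡M)))

conv-+ : ∀ M F G → conv M (λ c d → F c d + G c d) ≡ conv M F + conv M G
conv-+ zero    F G = refl
conv-+ (suc M) F G = trans (cong₂ _+_ (conv-+ M _ _) (conv-+ M _ _))
  (interchange (conv M λ c d → F (suc c) d) _ _ _)
  where
  interchange : ∀ a b c d → (a + b) + (c + d) ≡ (a + c) + (b + d)
  interchange = solve-∀

conv-*ˡ : ∀ M x F → conv M (λ c d → x * F c d) ≡ x * conv M F
conv-*ˡ zero    x F = refl
conv-*ˡ (suc M) x F = trans (cong₂ _+_ (conv-*ˡ M x _) (conv-*ˡ M x _)) (sym (*-distribˡ-+ x _ _))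

conv-zeroˡ : ∀ M {F} → (∀ c d → F (suc c) d ≡ 0) → conv M F ≡ F 0 M
conv-zeroˡ zero        F≡0 = refl
conv-zeroˡ (suc M) {F} F≡0 = cong₂ _+_
  (trans (conv-zeroˡ M λ c → F≡0 (suc c)) (F≡0 0 M))
  (conv-zeroˡ M λ c d → F≡0 c (suc d))

-- Both sides distribute `M` labelled cars over three boxes, weighted by trinomial coefficients. The
-- induction decides which of the three boxes receives one further car.
conv-assoc : ∀ M (F : ℕ → ℕ → ℕ → ℕ) →
  conv M (λ s r → conv s (λ c d → F c d r)) ≡ conv M (λ c r → conv r (λ d e → F c d e))
conv-assoc zero    F = refl
conv-assoc (suc M) F = begin
  conv M (λ s r → conv s (λ c d → F (suc c) d r) + conv s (λ c d → F c (suc d) r))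
    + conv M (λ s r → conv s (λ c d → F c d (suc r)))
    ≡⟨ cong (_+ conv M (λ s r → conv s (λ c d → F c d (suc r)))) (conv-+ M _ _) ⟩
  conv M (λ s r → conv s (λ c d → F (suc c) d r)) + conv M (λ s r → conv s (λ c d → F c (suc d) r))
    + conv M (λ s r → conv s (λ c d → F c d (suc r)))
    ≡⟨ +-assoc (conv M (λ s r → conv s (λ c d → F (suc c) d r))) _ _ ⟩
  conv M (λ s r → conv s (λ c d → F (suc c) d r)) + (conv M (λ s r → conv s (λ c d → F c (suc d) r))
    + conv M (λ s r → conv s (λ c d → F c d (suc r))))
    ≡⟨ cong₂ _+_ (conv-assoc M λ c → F (suc c))
         (cong₂ _+_ (conv-assoc M λ c d → F c (suc d)) (conv-assoc M λ c d r → F c d (suc r))) ⟩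
  conv M (λ c r → conv r (λ d e → F (suc c) d e)) + (conv M (λ c r → conv r (λ d e → F c (suc d) e))
    + conv M (λ c r → conv r (λ d e → F c d (suc e))))
    ≡⟨ cong (conv M (λ c r → conv r (λ d e → F (suc c) d e)) +_) (conv-+ M _ _) ⟨
  conv M (λ c r → conv r (λ d e → F (suc c) d e))
    + conv M (λ c r → conv r (λ d e → F c (suc d) e) + conv r (λ d e → F c d (suc e))) ∎
  where open ≡-Reasoning

-- Hitting time numbers.

-- H a s = a (a + s)^(s − 1) counts the parking functions with s cars and
-- a + s − 1 spots.
H : ℕ → ℕ → ℕ
H a zero    = 1
H a (suc s) = a * (a + suc s) ^ s

-- The factor `a + s` removes the exponent `s − 1`, so that `s = 0` is no longer special.
*-H : ∀ a s → (a + s) * H a s ≡ a * (a + s) ^ s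
*-H a zero    = cong (_* 1) (+-identityʳ a)
*-H a (suc s) = x[yz]≡y[xz] (a + suc s) a _
  where
  x[yz]≡y[xz] : ∀ x y z → x * (y * z) ≡ y * (x * z)
  x[yz]≡y[xz] = solve-∀

-- The binomial theorem and its derivative give `a (1 + x)^s + s (1 + x)^(s − 1)` for the sum; the
-- factor `suc x` avoids the exponent `s − 1`.
conv-linear*^ : ∀ s a x →
  suc x * conv s (λ c d → (a + c) * x ^ d) ≡ suc x ^ s * (a * suc x + s)
conv-linear*^ zero    a x = base a x
  where
  base : ∀ a x → suc x * ((a + 0) * 1) ≡ 1 * (a * suc x + 0)
  base = solve-∀
conv-linear*^ (suc s) a x = begin
  suc x * (conv s (λ c d → (a + suc c) * x ^ d) + conv s (λ c d → (a + c) * (x * x ^ d)))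
    ≡⟨ cong (suc x *_) (cong₂ _+_
         (conv-cong s λ c d _ → cong (_* x ^ d) (+-suc a c))
         (trans (conv-cong s λ c d _ → y[xz]≡x[yz] x (a + c) (x ^ d)) (conv-*ˡ s x _))) ⟩
  suc x * (conv s (λ c d → (suc a + c) * x ^ d) + x * conv s (λ c d → (a + c) * x ^ d))
    ≡⟨ distr x _ _ ⟩
  suc x * conv s (λ c d → (suc a + c) * x ^ d) + x * (suc x * conv s (λ c d → (a + c) * x ^ d))
    ≡⟨ cong₂ (λ y z → y + x * z) (conv-linear*^ s (suc a) x) (conv-linear*^ s a x) ⟩
  suc x ^ s * (suc a * suc x + s) + x * (suc x ^ s * (a * suc x + s))
    ≡⟨ combine (suc x ^ s) a x s ⟩
  suc x * suc x ^ s * (a * suc x + suc s) ∎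
  where
  open ≡-Reasoning
  y[xz]≡x[yz] : ∀ x y z → y * (x * z) ≡ x * (y * z)
  y[xz]≡x[yz] = solve-∀
  distr : ∀ x y z → suc x * (y + x * z) ≡ suc x * y + x * (suc x * z)
  distr = solve-∀
  combine : ∀ y a x s → y * (suc a * suc x + s) + x * (y * (a * suc x + s))
    ≡ suc x * y * (a * suc x + suc s)
  combine = solve-∀

-- The first-step recurrence of a skip-free walk started at height suc a.
conv-H : ∀ a s → conv s (λ c d → H (a + c) d) ≡ H (suc a) s
conv-H zero    zero    = refl
conv-H (suc a) zero    = refl
-- Two nonzero factors are inserted. Since `a + c + d = x` in every term, `x` turns each `H` into a
-- linear factor times a power of `x` by `*-H`; `suc x` prepares `conv-linear*^`.
conv-H a       (suc s) = *-cancelˡ-≡ _ _ (suc x) (*-cancelˡ-≡ _ _ x {{x≢0}} (begin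
  x * (suc x * conv (suc s) (λ c d → H (a + c) d))
    ≡⟨ swap x (suc x) _ ⟩
  suc x * (x * conv (suc s) (λ c d → H (a + c) d))
    ≡⟨ cong (suc x *_) (conv-*ˡ (suc s) x (λ c d → H (a + c) d)) ⟨
  suc x * conv (suc s) (λ c d → x * H (a + c) d)
    ≡⟨ cong (suc x *_) (conv-cong (suc s) λ c d c+d≡s →
         subst (λ y → y * H (a + c) d ≡ (a + c) * y ^ d)
           (trans (+-assoc a c d) (cong (a +_) c+d≡s)) (*-H (a + c) d)) ⟩
  suc x * conv (suc s) (λ c d → (a + c) * x ^ d)
    ≡⟨ conv-linear*^ (suc s) a x ⟩
  suc x ^ suc s * (a * suc x + suc s)
    ≡⟨ regroup (suc x ^ suc s) a s ⟩
  x * (suc a * suc x ^ suc s)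
    ≡⟨ cong (x *_) (*-H (suc a) (suc s)) ⟨
  x * (suc x * H (suc a) (suc s)) ∎))
  where
  open ≡-Reasoning
  x : ℕ
  x = a + suc s
  x≢0 : NonZero x
  x≢0 = subst NonZero (sym (+-suc a s)) _
  swap : ∀ x y z → x * (y * z) ≡ y * (x * z)
  swap = solve-∀
  regroup : ∀ y a s → y * (a * suc (a + suc s) + suc s) ≡ (a + suc s) * (suc a * y)
  regroup = solve-∀

-- Walks and their first passages.

-- passages p a M ts counts the walks, with M labelled cars, that start before spot
-- p at height a + l, first reach height l − i beyond spot tᵢ for i = 0,…,l − 1,
-- and end on first reaching height 0. The summation variable s is the number of
-- cars before height l is reached.
mutual
  passages : ∀ {l} → ℕ → ℕ → ℕ → Vec ℕ l → ℕ
  passages p a M ts = conv M (λ s d → H a s * afterPassage (p + a + s) d ts)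

  afterPassage : ∀ {l} → ℕ → ℕ → Vec ℕ l → ℕ
  afterPassage p d []       = ind (d ≟ 0)
  afterPassage p d (t ∷ ts) = ind (t <? p) * passages p 1 d ts

-- The walk already stands at the height it is to reach: `H 0 s` vanishes for positive `s`, and only
-- the term without cars survives.
passages-zero : ∀ {l} p M (ts : Vec ℕ l) → passages p 0 M ts ≡ afterPassage p M ts
passages-zero p M ts = begin
  conv M (λ s d → H 0 s * afterPassage (p + 0 + s) d ts)
    ≡⟨ conv-zeroˡ M (λ c d → refl) ⟩
  1 * afterPassage (p + 0 + 0) M ts
    ≡⟨ *-identityˡ _ ⟩
  afterPassage (p + 0 + 0) M ts
    ≡⟨ cong (λ q → afterPassage q M ts) (trans (+-identityʳ _) (+-identityʳ p)) ⟩
  afterPassage p M ts ∎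
  where open ≡-Reasoning

-- First-step analysis: if `c` cars prefer spot `p`, the height changes by `c − 1`. `conv-H` splits
-- the cars of the first passage accordingly and `conv-assoc` regroups them. The spot at which the
-- passage ends is the same from either start.
passages-suc : ∀ {l} p a M (ts : Vec ℕ l) → passages p (suc a) M ts ≡ conv M (λ c d → passages (suc p) (a + c) d ts)
passages-suc p a M ts = begin
  conv M (λ s r → H (suc a) s * afterPassage (p + suc a + s) r ts)
    ≡⟨ conv-cong M (λ s r _ → trans (cong (_* afterPassage (p + suc a + s) r ts) (sym (conv-H a s)))
         (trans (*-comm (conv s _) (afterPassage (p + suc a + s) r ts)) (sym (conv-*ˡ s (afterPassage (p + suc a + s) r ts) (λ c d → H (a + c) d))))) ⟩
  conv M (λ s r → conv s (λ c d → afterPassage (p + suc a + s) r ts * H (a + c) d))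
    ≡⟨ conv-cong M (λ s r _ → conv-cong s λ c d c+d≡s →
         trans (*-comm (afterPassage (p + suc a + s) r ts) _)
           (cong (λ q → H (a + c) d * afterPassage q r ts)
             (trans (cong (p + suc a +_) (sym c+d≡s)) (shift p a c d)))) ⟩
  conv M (λ s r → conv s (λ c d → H (a + c) d * afterPassage (suc p + (a + c) + d) r ts))
    ≡⟨ conv-assoc M (λ c d r → H (a + c) d * afterPassage (suc p + (a + c) + d) r ts) ⟩
  conv M (λ c r → conv r (λ d e → H (a + c) d * afterPassage (suc p + (a + c) + d) e ts)) ∎
  where
  open ≡-Reasoning
  shift : ∀ p a c d → p + suc a + (c + d) ≡ suc p + (a + c) + d
  shift = solve-∀

-- Words of preferences, and removal of the first spot.

above : ℕ → List ℕ → ℕ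
above k []       = 0
above k (x ∷ xs) = ind (k ≤? x) + above k xs

above-zero : ∀ xs → above 0 xs ≡ List.length xs
above-zero []       = refl
above-zero (x ∷ xs) = cong suc (above-zero xs)

above≤length : ∀ k xs → above k xs ≤ List.length xs
above≤length k []       = z≤n
above≤length k (x ∷ xs) = +-mono-≤ (ind≤1 (k ≤? x)) (above≤length k xs)
  where
  ind≤1 : (d : Dec P) → ind d ≤ 1
  ind≤1 (yes _) = ≤-refl
  ind≤1 (no _)  = z≤n

above-all : ∀ {l} k (ts : Vec ℕ l) → All (k ≤_) ts → above k (toList ts) ≡ l
above-all k []       []             = refl
above-all k (t ∷ ts) (k≤t ∷ k≤ts) = cong₂ _+_ (ind-yes (k ≤? t) k≤t) (above-all k ts k≤ts)

-- The street seen from its second spot: cars preferring the first spot leave the word, the other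
-- preferences are renumbered.
lower : List ℕ → List ℕ
lower []           = []
lower (zero  ∷ xs) = lower xs
lower (suc x ∷ xs) = x ∷ lower xs

above-lower : ∀ k xs → above (suc k) xs ≡ above k (lower xs)
above-lower k []           = refl
above-lower k (zero ∷ xs)  = above-lower k xs
above-lower k (suc x ∷ xs) =
  cong₂ _+_ (ind-cong (suc k ≤? suc x) (k ≤? x) s≤s⁻¹ s≤s) (above-lower k xs)

-- Summands take lists rather than vectors because `lower` changes the length of a word.
∑words : ℕ → ℕ → (List ℕ → ℕ) → ℕ
∑words n zero    f = f []
∑words n (suc M) f = ∑ {n} (λ x → ∑words n M (λ w → f (toℕ x ∷ w)))

∑words-cong : ∀ n M {f g} → (∀ w → List.length w ≡ M → f w ≡ g w) → ∑words n M f ≡ ∑words n M g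
∑words-cong n zero    f≡g = f≡g [] refl
∑words-cong n (suc M) f≡g =
  sum-cong-≗ {n} λ x → ∑words-cong n M λ w |w|≡M → f≡g (toℕ x ∷ w) (cong suc |w|≡M)

∑words-0 : ∀ n M → ∑words n M (λ _ → 0) ≡ 0
∑words-0 n zero    = refl
∑words-0 n (suc M) = ∑-zero {n} λ _ → ∑words-0 n M

conv-∑ : ∀ n M (F : Fin n → ℕ → ℕ → ℕ) → ∑ (λ x → conv M (F x)) ≡ conv M (λ c d → ∑ (λ x → F x c d))
conv-∑ n zero    F = refl
conv-∑ n (suc M) F = trans (∑-distrib-+ {n} _ _) (cong₂ _+_ (conv-∑ n M _) (conv-∑ n M _))

-- A word is determined by the positions of its zeros, chosen in as many ways as `conv` counts, and
-- by its lowered word of length `d`, which is arbitrary.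
∑words-lower : ∀ n M f → ∑words (suc n) M (f ∘ lower) ≡ conv M (λ c d → ∑words n d f)
∑words-lower n zero    f = refl
∑words-lower n (suc M) f = cong₂ _+_ (∑words-lower n M f)
  (trans (sum-cong-≗ {n} λ x → ∑words-lower n M (λ w → f (toℕ x ∷ w))) (conv-∑ n M _))

-- The counting criterion, matched with the walks.

-- The entries of w are counted from spot p, those of ts from the start of the street.
Good : ∀ {l} → ℕ → ℕ → Vec ℕ l → List ℕ → Set
Good p L ts w = (k : Fin (suc L)) → above (toℕ k) w + above (p + toℕ k) (toList ts) ≤ L ∸ toℕ k

good? : ∀ {l} p L (ts : Vec ℕ l) w → Dec (Good p L ts w)
good? p L ts w = all? λ k → above (toℕ k) w + above (p + toℕ k) (toList ts) ≤? L ∸ toℕ k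

#good : ∀ {l} → ℕ → ℕ → ℕ → Vec ℕ l → ℕ
#good p L M ts = ∑words L M (λ w → ind (good? p L ts w))

Good-lower : ∀ {l} p L (ts : Vec ℕ l) w → Good p (suc L) ts w → Good (suc p) L ts (lower w)
Good-lower p L ts w good k = subst₂ (λ x y → x + y ≤ L ∸ toℕ k)
  (above-lower (toℕ k) w) (cong (λ q → above q (toList ts)) (+-suc p (toℕ k))) (good (Fin.suc k))

-- Lowering loses only the condition at `k = 0`, that the street has room for everybody; the bound
-- on the lengths supplies it.
Good-raise : ∀ {l} p L (ts : Vec ℕ l) w → List.length w + l ≤ suc L →
  Good (suc p) L ts (lower w) → Good p (suc L) ts w
Good-raise {l} p L ts w |w|+l≤1+L good Fin.zero =
  ≤-trans (+-mono-≤ (above≤length 0 w) above≤l) |w|+l≤1+L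
  where
  above≤l : above (p + 0) (toList ts) ≤ l
  above≤l = subst (above (p + 0) (toList ts) ≤_) (length-toList ts) (above≤length (p + 0) (toList ts))
Good-raise p L ts w _ good (Fin.suc k) = subst₂ (λ x y → x + y ≤ L ∸ toℕ k)
  (sym (above-lower (toℕ k) w)) (cong (λ q → above q (toList ts)) (sym (+-suc p (toℕ k)))) (good k)

-- Sorting the words by the number `c` of cars preferring the first spot gives the recurrence of
-- `passages-suc`.
#good-suc : ∀ {l} p L M (ts : Vec ℕ l) → M + l ≤ suc L →
  #good p (suc L) M ts ≡ conv M (λ c d → #good (suc p) L d ts)
#good-suc {l} p L M ts M+l≤1+L = trans
  (∑words-cong (suc L) M λ w |w|≡M →
    ind-cong (good? p (suc L) ts w) (good? (suc p) L ts (lower w)) (Good-lower p L ts w)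
      (Good-raise p L ts w (subst (λ q → q + l ≤ suc L) (sym |w|≡M) M+l≤1+L)))
  (∑words-lower L M (λ w → ind (good? (suc p) L ts w)))

#good≡0 : ∀ {l} p L M (ts : Vec ℕ l) → L < M + above p (toList ts) → #good p L M ts ≡ 0
#good≡0 p L M ts L<M+ = trans
  (∑words-cong L M λ w |w|≡M → ind-no (good? p L ts w) λ good →
    <⇒≱ L<M+ (subst₂ (λ x y → x + above y (toList ts) ≤ L)
      (trans (above-zero w) |w|≡M) (+-identityʳ p) (good Fin.zero)))
  (∑words-0 L M)

#good-drop : ∀ {l} p L M t (ts : Vec ℕ l) → t < p → #good p L M (t ∷ ts) ≡ #good p L M ts
#good-drop p L M t ts t<p = ∑words-cong L M λ w _ →
  ind-cong (good? p L (t ∷ ts) w) (good? p L ts w)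
    (λ good k → subst (λ z → above (toℕ k) w + z ≤ L ∸ toℕ k) (dropped k) (good k))
    (λ good k → subst (λ z → above (toℕ k) w + z ≤ L ∸ toℕ k) (sym (dropped k)) (good k))
  where
  dropped : ∀ k → above (p + toℕ k) (toList (t ∷ ts)) ≡ above (p + toℕ k) (toList ts)
  dropped k = cong (_+ above (p + toℕ k) (toList ts))
    (ind-no (p + toℕ k ≤? t) (<⇒≱ (<-≤-trans t<p (m≤m+n p (toℕ k)))))

-- The equation says that the walk has height `a + l` before spot `p`. For positive `a` both sides
-- obey the same first-step recurrence. At `a = 0` the first threshold is tested: if it lies behind
-- `p`, it drops out of the criterion and the next height to reach is one lower; otherwise too many
-- cars want the rest of the street.
#good≡passages : ∀ {l} p L a M (ts : Vec ℕ l) → AllPairs _≤_ ts → suc L ≡ a + (l + M) →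
  #good p L M ts ≡ passages p a M ts
#good≡passages p L zero M [] _ refl =
  trans (#good≡0 p L (suc L) [] (s≤s (≤-reflexive (sym (+-identityʳ L)))))
    (sym (passages-zero p (suc L) []))
#good≡passages {suc l} p L zero M (t ∷ ts) (t≤ts ∷ sorted) eq =
  trans (byThreshold (t <? p)) (sym (passages-zero p M (t ∷ ts)))
  where
  byThreshold : (d : Dec (t < p)) → #good p L M (t ∷ ts) ≡ ind d * passages p 1 M ts
  byThreshold (yes t<p) = trans (#good-drop p L M t ts t<p)
    (trans (#good≡passages p L 1 M ts sorted eq) (sym (*-identityˡ _)))
  -- As the thresholds are sorted, all `suc l` of them lie at `p` or beyond. Together with the `M`
  -- cars they exceed the remaining `l + M` spots by one.
  byThreshold (no t≮p)  = #good≡0 p L M (t ∷ ts) (begin-strict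
    L                                ≡⟨ suc-injective eq ⟩
    l + M                            <⟨ n<1+n _ ⟩
    suc l + M                        ≡⟨ +-comm (suc l) M ⟩
    M + suc l                        ≡⟨ cong (M +_) (above-all p (t ∷ ts) p≤ts) ⟨
    M + above p (toList (t ∷ ts))    ∎)
    where
    open ≤-Reasoning
    p≤ts : All (p ≤_) (t ∷ ts)
    p≤ts = ≮⇒≥ t≮p ∷ All.map (≤-trans (≮⇒≥ t≮p)) t≤ts
-- At the end of the street the equation leaves only height 1, without cars or thresholds; the added
-- one in the height is what remains.
#good≡passages p zero (suc zero) zero [] _ refl = refl
#good≡passages {l} p (suc L) (suc a) M ts sorted eq = begin
  #good p (suc L) M ts
    ≡⟨ #good-suc p L M ts M+l≤1+L ⟩
  conv M (λ c d → #good (suc p) L d ts)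
    ≡⟨ conv-cong M (λ c d c+d≡M → #good≡passages (suc p) L (a + c) d ts sorted
         (trans (suc-injective eq) (trans (cong (λ q → a + (l + q)) (sym c+d≡M)) (shift a l c d)))) ⟩
  conv M (λ c d → passages (suc p) (a + c) d ts)
    ≡⟨ passages-suc p a M ts ⟨
  passages p (suc a) M ts ∎
  where
  open ≡-Reasoning
  shift : ∀ a l c d → a + (l + (c + d)) ≡ a + c + (l + d)
  shift = solve-∀
  M+l≤1+L : M + l ≤ suc L
  M+l≤1+L = ≤-trans (m≤n+m (M + l) a)
    (≤-reflexive (trans (cong (a +_) (+-comm M l)) (sym (suc-injective eq))))

-- The parking process and the counting criterion.

nums : ∀ {m n} → Vec (Fin n) m → List ℕ
nums = toList ∘ Vec.map toℕ

-- The function `f` is general because the tail of `allFin` is not again an `allFin`; the induction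
-- needs this, and the applications take `id`.
find-tabulate : ∀ {A : Set} {P : A → Set} (P? : Decidable P) {n} (f : Fin n → A) →
  (find P? (tabulate f) ≡ nothing × (∀ i → ¬ P (f i))) ⊎
  (∃ λ q → find P? (tabulate f) ≡ just (f q) × P (f q) × (∀ j → j Fin.< q → ¬ P (f j)))
find-tabulate P? {zero}  f = inj₁ (refl , λ ())
find-tabulate P? {suc n} f with P? (f Fin.zero) | find-tabulate P? (f ∘ Fin.suc)
... | yes p | _ = inj₂ (Fin.zero , refl , p , λ _ ())
... | no ¬p | inj₁ (eq , none) = inj₁ (eq , λ { Fin.zero → ¬p ; (Fin.suc i) → none i })
... | no ¬p | inj₂ (q , eq , p , first) = inj₂ (Fin.suc q , eq , p ,
  λ { Fin.zero _ → ¬p ; (Fin.suc j) j<q → first j (s≤s⁻¹ j<q) })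

free : ∀ {n} → Subset n → ℕ → ℕ
free O k = ∑ λ i → ind ((k ≤? toℕ i) ×-dec ¬? (i ∈? O))

-- Hall's condition for the cars still to park, relative to the spots already taken.
Parks : ∀ {n} → Subset n → List ℕ → Set
Parks {n} O xs = (k : Fin (suc n)) → above (toℕ k) xs ≤ free O (toℕ k)

∑-mono-≤ : ∀ {n} {f g : Fin n → ℕ} → (∀ i → f i ≤ g i) → ∑ f ≤ ∑ g
∑-mono-≤ {zero}  f≤g = z≤n
∑-mono-≤ {suc n} f≤g = +-mono-≤ (f≤g Fin.zero) (∑-mono-≤ (f≤g ∘ Fin.suc))

free-occupy : ∀ {n} (O : Subset n) q k → q ∉ O →
  free O k ≡ ind (k ≤? toℕ q) + free (O ∪ ⁅ q ⁆) k
free-occupy O q k q∉O = begin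
  ∑ (λ i → ind ((k ≤? toℕ i) ×-dec ¬? (i ∈? O)))
    ≡⟨ sum-cong-≗ pointwise ⟩
  ∑ (λ i → ind (i Fin.≟ q) * ind (k ≤? toℕ i) + ind ((k ≤? toℕ i) ×-dec ¬? (i ∈? (O ∪ ⁅ q ⁆))))
    ≡⟨ ∑-distrib-+ (λ i → ind (i Fin.≟ q) * ind (k ≤? toℕ i)) _ ⟩
  ∑ (λ i → ind (i Fin.≟ q) * ind (k ≤? toℕ i)) + free (O ∪ ⁅ q ⁆) k
    ≡⟨ cong (_+ free (O ∪ ⁅ q ⁆) k) (∑-delta q λ i → ind (k ≤? toℕ i)) ⟩
  ind (k ≤? toℕ q) + free (O ∪ ⁅ q ⁆) k ∎
  where
  open ≡-Reasoning
  pointwise : ∀ i → ind ((k ≤? toℕ i) ×-dec ¬? (i ∈? O)) ≡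
    ind (i Fin.≟ q) * ind (k ≤? toℕ i) + ind ((k ≤? toℕ i) ×-dec ¬? (i ∈? (O ∪ ⁅ q ⁆)))
  pointwise i with i Fin.≟ q
  ... | yes refl = begin
    ind ((k ≤? toℕ q) ×-dec ¬? (q ∈? O))
      ≡⟨ ind-cong ((k ≤? toℕ q) ×-dec ¬? (q ∈? O)) (k ≤? toℕ q) proj₁ (_, q∉O) ⟩
    ind (k ≤? toℕ q)
      ≡⟨ trans (+-identityʳ _) (+-identityʳ _) ⟨
    ind (k ≤? toℕ q) + 0 + 0
      ≡⟨ cong (ind (k ≤? toℕ q) + 0 +_) (sym (ind-no ((k ≤? toℕ q) ×-dec ¬? (q ∈? (O ∪ ⁅ q ⁆)))
           λ (_ , q∉) → q∉ (x∈p∪q⁺ (inj₂ (x∈⁅x⁆ q))))) ⟩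
    ind (k ≤? toℕ q) + 0 + ind ((k ≤? toℕ q) ×-dec ¬? (q ∈? (O ∪ ⁅ q ⁆))) ∎
  ... | no i≢q = ind-cong ((k ≤? toℕ i) ×-dec ¬? (i ∈? O)) ((k ≤? toℕ i) ×-dec ¬? (i ∈? (O ∪ ⁅ q ⁆)))
    (λ (k≤i , i∉O) → k≤i , λ i∈ → split i∉O (x∈p∪q⁻ O ⁅ q ⁆ i∈))
    (λ (k≤i , i∉)  → k≤i , λ i∈O → i∉ (x∈p∪q⁺ (inj₁ i∈O)))
    where
    split : i ∉ O → ¬ (i ∈ O ⊎ i ∈ ⁅ q ⁆)
    split i∉O (inj₁ i∈O) = i∉O i∈O
    split i∉O (inj₂ i∈q) = i≢q (x∈⁅y⁆⇒x≡y q i∈q)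

above-anti : ∀ {j k} → j ≤ k → ∀ xs → above k xs ≤ above j xs
above-anti j≤k []       = z≤n
above-anti {j} {k} j≤k (x ∷ xs) =
  +-mono-≤ (ind-mono (k ≤? x) (j ≤? x) (≤-trans j≤k)) (above-anti j≤k xs)

-- Parking uses up a spot beyond `k` without removing a car preferring such a spot only if
-- `p < k ≤ q`. In that case the condition at `p` is stronger than the one at `k`, because no free
-- spot lies between.
Parks-∷⁻ : ∀ {n} (O : Subset n) (p q : Fin n) xs → p Fin.≤ q → q ∉ O →
  (∀ j → j Fin.< q → ¬ (p Fin.≤ j × j ∉ O)) →
  Parks O (toℕ p ∷ xs) → Parks (O ∪ ⁅ q ⁆) xs
Parks-∷⁻ O p q xs p≤q q∉O first parks k =
  +-cancelˡ-≤ (ind (toℕ k ≤? toℕ q)) _ _ (≤-trans (bound (toℕ k ≤? toℕ p) (toℕ k ≤? toℕ q))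
    (≤-reflexive (free-occupy O q (toℕ k) q∉O)))
  where
  bound : (d : Dec (toℕ k ≤ toℕ p)) (e : Dec (toℕ k ≤ toℕ q)) →
    ind e + above (toℕ k) xs ≤ free O (toℕ k)
  bound d (no _) = ≤-trans (m≤n+m _ _) (parks k)
  bound (yes k≤p) (yes _) =
    subst (λ z → z + above (toℕ k) xs ≤ free O (toℕ k)) (ind-yes (toℕ k ≤? toℕ p) k≤p) (parks k)
  -- The condition is read off at `p`, where the arriving car is counted. Every free spot from `p`
  -- on lies at `q` or later, hence at `k` or later.
  bound (no k≰p) (yes k≤q) = begin
    1 + above (toℕ k) xs
      ≤⟨ s≤s (above-anti (<⇒≤ (≰⇒> k≰p)) xs) ⟩
    1 + above (toℕ p) xs
      ≡⟨ cong (_+ above (toℕ p) xs) (ind-yes (toℕ p ≤? toℕ p) ≤-refl) ⟨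
    above (toℕ p) (toℕ p ∷ xs)
      ≤⟨ subst (λ z → above z (toℕ p ∷ xs) ≤ free O z) (toℕ-inject₁ p) (parks (Fin.inject₁ p)) ⟩
    free O (toℕ p)
      ≤⟨ ∑-mono-≤ (λ i → ind-mono ((toℕ p ≤? toℕ i) ×-dec ¬? (i ∈? O)) ((toℕ k ≤? toℕ i) ×-dec ¬? (i ∈? O))
           λ (p≤i , i∉O) → ≤-trans k≤q (≮⇒≥ λ i<q → first i i<q (p≤i , i∉O)) , i∉O) ⟩
    free O (toℕ k) ∎
    where open ≤-Reasoning

-- As `p ≤ q`, every stretch whose demand grows by the new car also regains the spot `q`.
Parks-∷⁺ : ∀ {n} (O : Subset n) (p q : Fin n) xs → p Fin.≤ q → q ∉ O →
  Parks (O ∪ ⁅ q ⁆) xs → Parks O (toℕ p ∷ xs)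
Parks-∷⁺ O p q xs p≤q q∉O parks k = ≤-trans
  (+-mono-≤ (ind-mono (toℕ k ≤? toℕ p) (toℕ k ≤? toℕ q) (λ k≤p → ≤-trans k≤p p≤q)) (parks k))
  (≤-reflexive (sym (free-occupy O q (toℕ k) q∉O)))

parks⇒park : ∀ {m n} (O : Subset n) (π : Vec (Fin n) m) → Parks O (nums π) → Is-just (park O π)
parks⇒park O []      parks = just tt
parks⇒park {n = n} O (p ∷ π) parks
  with find-tabulate (λ q → (p Fin.≤? q) ×-dec ¬? (q ∈? O)) id
... | inj₂ (q , eq , (p≤q , q∉O) , first) rewrite eq =
  parks⇒park (O ∪ ⁅ q ⁆) π (Parks-∷⁻ O p q (nums π) p≤q q∉O first parks)
-- Without a free spot from `p` on, the arriving car alone violates the condition at `p`.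
... | inj₁ (_ , none) = ⊥-elim (<⇒≱ occupied (parks (Fin.inject₁ p)))
  where
  occupied : free O (toℕ (Fin.inject₁ p)) < above (toℕ (Fin.inject₁ p)) (toℕ p ∷ nums π)
  occupied rewrite toℕ-inject₁ p
    | ∑-zero {n} (λ i → ind-no ((toℕ p ≤? toℕ i) ×-dec ¬? (i ∈? O)) (none i))
    | ind-yes (toℕ p ≤? toℕ p) ≤-refl = s≤s z≤n

park⇒parks : ∀ {m n} (O : Subset n) (π : Vec (Fin n) m) → Is-just (park O π) → Parks O (nums π)
park⇒parks O []      _ k = z≤n
park⇒parks O (p ∷ π) parked
  with find-tabulate (λ q → (p Fin.≤? q) ×-dec ¬? (q ∈? O)) id
... | inj₁ (eq , _) rewrite eq = λ _ → ⊥-elim (nothing-parked parked)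
  where
  nothing-parked : ¬ Is-just nothing
  nothing-parked ()
... | inj₂ (q , eq , (p≤q , q∉O) , _) rewrite eq =
  Parks-∷⁺ O p q (nums π) p≤q q∉O (park⇒parks (O ∪ ⁅ q ⁆) π parked)

∑-≥ : ∀ n k → ∑ {n} (λ i → ind (k ≤? toℕ i)) ≡ n ∸ k
∑-≥ zero    k       = sym (0∸n≡0 k)
∑-≥ (suc n) zero    = cong suc (∑-≥ n 0)
∑-≥ (suc n) (suc k) = trans
  (sum-cong-≗ {n} λ i → ind-cong (suc k ≤? suc (toℕ i)) (k ≤? toℕ i) s≤s⁻¹ s≤s) (∑-≥ n k)

free-∅ : ∀ n k → free {n} ∅ k ≡ n ∸ k
free-∅ n k = trans
  (sum-cong-≗ {n} λ i → ind-cong ((k ≤? toℕ i) ×-dec ¬? (i ∈? ∅)) (k ≤? toℕ i) proj₁ (_, ∉⊥))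
  (∑-≥ n k)

-- Sums over enumerated words.

module _ {A : Set} where

  sum-map-cong : {f g : A → ℕ} → f ≗ g → ∀ xs → sum (List.map f xs) ≡ sum (List.map g xs)
  sum-map-cong f≗g []       = refl
  sum-map-cong f≗g (x ∷ xs) = cong₂ _+_ (f≗g x) (sum-map-cong f≗g xs)

  *-distribˡ-sum-map : ∀ c (f : A → ℕ) xs →
    c * sum (List.map f xs) ≡ sum (List.map (λ x → c * f x) xs)
  *-distribˡ-sum-map c f []       = *-zeroʳ c
  *-distribˡ-sum-map c f (x ∷ xs) =
    trans (*-distribˡ-+ c (f x) _) (cong (c * f x +_) (*-distribˡ-sum-map c f xs))

  sum-map-filter : ∀ {P : A → Set} (P? : Decidable P) (f : A → ℕ) xs →
    sum (List.map f (filter P? xs)) ≡ sum (List.map (λ x → ind (P? x) * f x) xs)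
  sum-map-filter P? f []       = refl
  sum-map-filter P? f (x ∷ xs) with P? x
  ... | yes _ = cong₂ _+_ (sym (+-identityʳ (f x))) (sum-map-filter P? f xs)
  ... | no _  = sum-map-filter P? f xs

  length-filter : ∀ {P : A → Set} (P? : Decidable P) xs →
    length (filter P? xs) ≡ sum (List.map (λ x → ind (P? x)) xs)
  length-filter P? []       = refl
  length-filter P? (x ∷ xs) with P? x
  ... | yes _ = cong suc (length-filter P? xs)
  ... | no _  = length-filter P? xs

  sum-words : ∀ k (xs : List A) (f : Vec A (suc k) → ℕ) →
    sum (List.map f (words (suc k) xs)) ≡
    sum (List.map (λ x → sum (List.map (λ w → f (x ∷ w)) (words k xs))) xs)
  sum-words k xs f = go xs
    where
    ws : List (Vec A k)
    ws = words k xs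
    go : ∀ ys → sum (List.map f (cartesianProductWith _∷_ ys ws)) ≡
      sum (List.map (λ x → sum (List.map (λ w → f (x ∷ w)) ws)) ys)
    go []       = refl
    go (y ∷ ys) = begin
      sum (List.map f (List.map (y ∷_) ws ++ cartesianProductWith _∷_ ys ws))
        ≡⟨ cong sum (map-++ f (List.map (y ∷_) ws) _) ⟩
      sum (List.map f (List.map (y ∷_) ws) ++ List.map f (cartesianProductWith _∷_ ys ws))
        ≡⟨ sum-++ (List.map f (List.map (y ∷_) ws)) _ ⟩
      sum (List.map f (List.map (y ∷_) ws)) + sum (List.map f (cartesianProductWith _∷_ ys ws))
        ≡⟨ cong₂ _+_ (cong sum (sym (map-∘ ws))) (go ys) ⟩
      sum (List.map (λ w → f (y ∷ w)) ws)
        + sum (List.map (λ x → sum (List.map (λ w → f (x ∷ w)) ws)) ys) ∎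
      where open ≡-Reasoning

sum-tabulate : ∀ {n} (f : Fin n → ℕ) → sum (tabulate f) ≡ ∑ f
sum-tabulate {zero}  f = refl
sum-tabulate {suc n} f = cong (f Fin.zero +_) (sum-tabulate (f ∘ Fin.suc))

sum-words-allFin : ∀ n k (f : Vec (Fin n) (suc k) → ℕ) →
  sum (List.map f (words (suc k) (allFin n))) ≡
  ∑ (λ x → sum (List.map (λ w → f (x ∷ w)) (words k (allFin n))))
sum-words-allFin n k f = trans (sum-words k (allFin n) f)
  (trans (cong sum (map-tabulate {n = n} id _)) (sum-tabulate {n} _))

∑words-nums : ∀ n m (f : List ℕ → ℕ) →
  sum (List.map (f ∘ nums) (words m (allFin n))) ≡ ∑words n m f
∑words-nums n zero    f = +-identityʳ (f [])
∑words-nums n (suc m) f = trans (sum-words-allFin n m (f ∘ nums))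
  (sum-cong-≗ {n} λ x → ∑words-nums n m λ w → f (toℕ x ∷ w))

-- Each prescribed entry collapses the sum over one letter to a single term; the letters after the
-- prefix remain free.
∑words-startsWith : ∀ {l m n} (l≤m : l ≤ m) (v : Vec (Fin n) l) (f : List ℕ → ℕ) →
  sum (List.map (λ π → ind (startsWith? l≤m v π) * f (nums π)) (words m (allFin n))) ≡
  ∑words n (m ∸ l) (λ w → f (nums v ++ w))
∑words-startsWith {m = m} {n} l≤m [] f = trans
  (sum-map-cong (λ π → trans (cong (_* f (nums π)) (ind-yes (startsWith? l≤m [] π) λ ())) (*-identityˡ _))
    (words m (allFin n)))
  (∑words-nums n m f)
∑words-startsWith {suc l} {suc m} {n} l≤m (x ∷ v) f = begin
  sum (List.map (λ π → ind (startsWith? l≤m (x ∷ v) π) * f (nums π)) (words (suc m) (allFin n)))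
    ≡⟨ sum-words-allFin n m _ ⟩
  ∑ (λ y → sum (List.map (λ π → ind (startsWith? l≤m (x ∷ v) (y ∷ π)) * f (toℕ y ∷ nums π)) ws))
    ≡⟨ sum-cong-≗ {n} (λ y → trans
         (sum-map-cong (λ π → trans (cong (_* f (toℕ y ∷ nums π)) (split y π)) (*-assoc (ind (y Fin.≟ x)) _ _)) ws)
         (sym (*-distribˡ-sum-map (ind (y Fin.≟ x)) _ ws))) ⟩
  ∑ (λ y → ind (y Fin.≟ x) *
    sum (List.map (λ π → ind (startsWith? (s≤s⁻¹ l≤m) v π) * f (toℕ y ∷ nums π)) ws))
    ≡⟨ ∑-delta x _ ⟩
  sum (List.map (λ π → ind (startsWith? (s≤s⁻¹ l≤m) v π) * f (toℕ x ∷ nums π)) ws)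
    ≡⟨ ∑words-startsWith (s≤s⁻¹ l≤m) v (λ w → f (toℕ x ∷ w)) ⟩
  ∑words n (m ∸ l) (λ w → f (toℕ x ∷ nums v ++ w)) ∎
  where
  open ≡-Reasoning
  ws : List (Vec (Fin n) m)
  ws = words m (allFin n)
  split : ∀ y π → ind (startsWith? l≤m (x ∷ v) (y ∷ π)) ≡
    ind (y Fin.≟ x) * ind (startsWith? (s≤s⁻¹ l≤m) v π)
  split y π = trans
    (ind-cong (startsWith? l≤m (x ∷ v) (y ∷ π)) ((y Fin.≟ x) ×-dec startsWith? (s≤s⁻¹ l≤m) v π)
      (λ starts → starts Fin.zero , starts ∘ Fin.suc)
      (λ { (y≡x , starts) Fin.zero → y≡x ; (y≡x , starts) (Fin.suc i) → starts i }))
    (ind-× (y Fin.≟ x) (startsWith? (s≤s⁻¹ l≤m) v π))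

above-++ : ∀ k xs ys → above k (xs ++ ys) ≡ above k xs + above k ys
above-++ k []       ys = refl
above-++ k (x ∷ xs) ys =
  trans (cong (ind (k ≤? x) +_) (above-++ k xs ys)) (sym (+-assoc (ind (k ≤? x)) _ _))

-- The criterion does not see the order of the cars. The prescribed cars can therefore be moved
-- behind the others and become the thresholds of `Good`.
#PF≡#good : ∀ {l m n} (l≤m : l ≤ m) (v : Vec (Fin n) l) →
  #PF l≤m v ≡ #good 0 n (m ∸ l) (Vec.map toℕ v)
#PF≡#good {l} {m} {n} l≤m v = begin
  length (filter (startsWith? l≤m v) (filter isParkingFunction? ws))
    ≡⟨ length-filter (startsWith? l≤m v) (filter isParkingFunction? ws) ⟩
  sum (List.map (λ π → ind (startsWith? l≤m v π)) (filter isParkingFunction? ws))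
    ≡⟨ sum-map-filter isParkingFunction? _ ws ⟩
  sum (List.map (λ π → ind (isParkingFunction? π) * ind (startsWith? l≤m v π)) ws)
    ≡⟨ sum-map-cong (λ π → trans (*-comm (ind (isParkingFunction? π)) _)
         (cong (ind (startsWith? l≤m v π) *_)
           (ind-cong (isParkingFunction? π) (good? 0 n [] (nums π)) (to π) (from π)))) ws ⟩
  sum (List.map (λ π → ind (startsWith? l≤m v π) * ind (good? 0 n [] (nums π))) ws)
    ≡⟨ ∑words-startsWith l≤m v (λ w → ind (good? 0 n [] w)) ⟩
  ∑words n (m ∸ l) (λ w → ind (good? 0 n [] (nums v ++ w)))
    ≡⟨ ∑words-cong n (m ∸ l) (λ w _ → ind-cong (good? 0 n [] (nums v ++ w)) (good? 0 n (Vec.map toℕ v) w)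
         (λ good k → subst (_≤ n ∸ toℕ k) (move (toℕ k) w) (good k))
         (λ good k → subst (_≤ n ∸ toℕ k) (sym (move (toℕ k) w)) (good k))) ⟩
  #good 0 n (m ∸ l) (Vec.map toℕ v) ∎
  where
  open ≡-Reasoning
  ws : List (Vec (Fin n) m)
  ws = words m (allFin n)
  to : ∀ π → IsParkingFunction π → Good 0 n [] (nums π)
  to π parked k = subst₂ _≤_ (sym (+-identityʳ _)) (free-∅ n (toℕ k)) (park⇒parks ∅ π parked k)
  from : ∀ (π : Vec (Fin n) m) → Good 0 n [] (nums π) → IsParkingFunction π
  from π good = parks⇒park ∅ π λ k → subst₂ _≤_ (+-identityʳ _) (sym (free-∅ n (toℕ k))) (good k)
  move : ∀ k w → above k (nums v ++ w) + 0 ≡ above k w + above k (nums v)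
  move k w = trans (+-identityʳ _) (trans (above-++ k (nums v) w) (+-comm (above k (nums v)) _))

-- From iterated convolutions to a multinomial sum.

sum-applyUpTo-cong : ∀ {f g : ℕ → ℕ} → f ≗ g → ∀ n → sum (applyUpTo f n) ≡ sum (applyUpTo g n)
sum-applyUpTo-cong f≗g zero    = refl
sum-applyUpTo-cong f≗g (suc n) = cong₂ _+_ (f≗g 0) (sum-applyUpTo-cong (f≗g ∘ suc) n)

sum-applyUpTo-0 : ∀ {f : ℕ → ℕ} → (∀ i → f i ≡ 0) → ∀ n → sum (applyUpTo f n) ≡ 0
sum-applyUpTo-0 f≡0 zero    = refl
sum-applyUpTo-0 f≡0 (suc n) = cong₂ _+_ (f≡0 0) (sum-applyUpTo-0 (f≡0 ∘ suc) n)

sum-applyUpTo-+ : ∀ (f g : ℕ → ℕ) n →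
  sum (applyUpTo (λ i → f i + g i) n) ≡ sum (applyUpTo f n) + sum (applyUpTo g n)
sum-applyUpTo-+ f g zero    = refl
sum-applyUpTo-+ f g (suc n) =
  trans (cong ((f 0 + g 0) +_) (sum-applyUpTo-+ (f ∘ suc) (g ∘ suc) n)) (interchange (f 0) (g 0) _ _)
  where
  interchange : ∀ a b c d → (a + b) + (c + d) ≡ (a + c) + (b + d)
  interchange = solve-∀

-- The range up to `K` is independent of `M`, since `S` enumerates all coordinates over one common
-- range while `M` shrinks along the blocks. Terms with `c > M` have binomial coefficient 0.
conv≡sum : ∀ K M → M ≤ K → (F : ℕ → ℕ → ℕ) →
  conv M F ≡ sum (applyUpTo (λ c → (M C c) * F c (M ∸ c)) (suc K))
conv≡sum K zero _ F = sym (trans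
  (cong (((0 C 0) * F 0 0) +_) (sum-applyUpTo-0
    (λ c → refl) K))
  (trans (+-identityʳ _) (*-identityˡ _)))
conv≡sum (suc K) (suc M) (s≤s M≤K) F = begin
  conv M (λ c d → F (suc c) d) + conv M (λ c d → F c (suc d))
    ≡⟨ cong₂ _+_ (conv≡sum K M M≤K (λ c d → F (suc c) d)) (conv≡sum (suc K) M (m≤n⇒m≤1+n M≤K) (λ c d → F c (suc d))) ⟩
  x + (y + z)
    ≡⟨ rotate x y z ⟩
  y + (x + z)
    ≡⟨ cong (y +_) (sum-applyUpTo-+ (λ c → (M C c) * F (suc c) (M ∸ c))
         (λ c → (M C suc c) * F (suc c) (suc (M ∸ suc c))) (suc K)) ⟨
  y + sum (applyUpTo (λ c → (M C c) * F (suc c) (M ∸ c) + (M C suc c) * F (suc c) (suc (M ∸ suc c))) (suc K))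
    ≡⟨ cong (y +_) (sum-applyUpTo-cong pascal (suc K)) ⟩
  y + sum (applyUpTo (λ c → (suc M C suc c) * F (suc c) (M ∸ c)) (suc K)) ∎
  where
  open ≡-Reasoning
  x y z : ℕ
  x = sum (applyUpTo (λ c → (M C c) * F (suc c) (M ∸ c)) (suc K))
  y = (M C 0) * F 0 (suc M)
  z = sum (applyUpTo (λ c → (M C suc c) * F (suc c) (suc (M ∸ suc c))) (suc K))
  rotate : ∀ x y z → x + (y + z) ≡ y + (x + z)
  rotate = solve-∀
  -- Truncated subtraction spoils the identity of the arguments only for `c ≥ M`, where the binomial
  -- coefficient vanishes.
  shift : ∀ c → (M C suc c) * F (suc c) (suc (M ∸ suc c)) ≡ (M C suc c) * F (suc c) (M ∸ c)
  shift c with suc c ≤? M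
  ... | yes c<M = cong (λ d → (M C suc c) * F (suc c) d) (sym (+-∸-assoc 1 c<M))
  ... | no c≮M rewrite k>n⇒nCk≡0 (≰⇒> c≮M) = refl
  pascal : ∀ c → (M C c) * F (suc c) (M ∸ c) + (M C suc c) * F (suc c) (suc (M ∸ suc c))
    ≡ (suc M C suc c) * F (suc c) (M ∸ c)
  pascal c = trans (cong (((M C c) * F (suc c) (M ∸ c)) +_) (shift c))
    (trans (sym (*-distribʳ-+ (F (suc c) (M ∸ c)) (M C c) _))
      (cong (_* F (suc c) (M ∸ c)) (nCk+nC[k+1]≡[n+1]C[k+1] M c)))

-- The multinomial coefficient in the form that iterating `conv` produces, free of division.
multinomialℕ : ∀ {k} → Vec ℕ k → ℕ
multinomialℕ []      = 1
multinomialℕ (c ∷ s) = ((c + Vec.sum s) C c) * multinomialℕ s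

-- The product of the powers `(c + 1)^(c − 1)`; `H 1 0 = 1` is the case of exponent -1.
∏H : ∀ {k} → Vec ℕ k → ℕ
∏H []      = 1
∏H (c ∷ s) = H 1 c * ∏H s

-- A descent by one during which `c` cars are met covers `c + 1` spots. The right-hand side is thus
-- the spot before which the walk stands when threshold `i` is tested.
Beyond : ∀ {l} → ℕ → Vec ℕ l → Vec ℕ l → Set
Beyond p ts s = ∀ i → lookup ts i < p + (toℕ i + partialSum (toℕ i) s)

beyond? : ∀ {l} p (ts s : Vec ℕ l) → Dec (Beyond p ts s)
beyond? p ts s = all? λ i → lookup ts i <? p + (toℕ i + partialSum (toℕ i) s)

ind-beyond-∷ : ∀ {l} p t c (ts s : Vec ℕ l) →
  ind (beyond? p (t ∷ ts) (c ∷ s)) ≡ ind (t <? p) * ind (beyond? (p + 1 + c) ts s)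
ind-beyond-∷ p t c ts s = trans
  (ind-cong (beyond? p (t ∷ ts) (c ∷ s)) ((t <? p) ×-dec beyond? (p + 1 + c) ts s)
    (λ b → subst (t <_) (+-identityʳ p) (b Fin.zero) ,
      λ i → subst (lookup ts i <_) (shift p c (toℕ i) (partialSum (toℕ i) s)) (b (Fin.suc i)))
    (λ { (t<p , b) Fin.zero    → subst (t <_) (sym (+-identityʳ p)) t<p
       ; (t<p , b) (Fin.suc i) →
           subst (lookup ts i <_) (sym (shift p c (toℕ i) (partialSum (toℕ i) s))) (b i) }))
  (ind-× (t <? p) (beyond? (p + 1 + c) ts s))
  where
  shift : ∀ p c i σ → p + (suc i + (c + σ)) ≡ p + 1 + c + (i + σ)
  shift = solve-∀

afterPassageTerm : ∀ {l} → ℕ → ℕ → Vec ℕ l → Vec ℕ l → ℕ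
afterPassageTerm p M ts s = ind (beyond? p ts s) * (ind (Vec.sum s ≟ M) * (multinomialℕ s * ∏H s))

passageTerm : ∀ {l} → ℕ → ℕ → ℕ → Vec ℕ l → Vec ℕ (suc l) → ℕ
passageTerm p a M ts (c ∷ s) =
  ind (beyond? (p + a + c) ts s) *
    (ind (Vec.sum (c ∷ s) ≟ M) * (multinomialℕ (c ∷ s) * (H a c * ∏H s)))

mutual
  afterPassage≡sum : ∀ {l} K p M (ts : Vec ℕ l) → M ≤ K →
    afterPassage p M ts ≡ sum (List.map (afterPassageTerm p M ts) (words l (upTo (suc K))))
  afterPassage≡sum K p M [] M≤K = trans (ind-cong (M ≟ 0) (0 ≟ M) sym sym) (sym (begin
    afterPassageTerm p M [] [] + 0
      ≡⟨ +-identityʳ _ ⟩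
    ind (beyond? p [] []) * (ind (0 ≟ M) * 1)
      ≡⟨ cong₂ _*_ (ind-yes (beyond? p [] []) λ ()) (*-identityʳ _) ⟩
    1 * ind (0 ≟ M)
      ≡⟨ *-identityˡ _ ⟩
    ind (0 ≟ M) ∎))
    where open ≡-Reasoning
  afterPassage≡sum {suc l} K p M (t ∷ ts) M≤K = begin
    ind (t <? p) * passages p 1 M ts
      ≡⟨ cong (ind (t <? p) *_) (passages≡sum K p 1 M ts M≤K) ⟩
    ind (t <? p) * sum (List.map (passageTerm p 1 M ts) ws)
      ≡⟨ *-distribˡ-sum-map (ind (t <? p)) _ ws ⟩
    sum (List.map (λ s → ind (t <? p) * passageTerm p 1 M ts s) ws)
      ≡⟨ sum-map-cong (λ { (c ∷ s) → trans (sym (*-assoc (ind (t <? p)) _ _))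
           (cong (_* (ind (Vec.sum (c ∷ s) ≟ M) * (multinomialℕ (c ∷ s) * ∏H (c ∷ s))))
             (sym (ind-beyond-∷ p t c ts s))) }) ws ⟩
    sum (List.map (afterPassageTerm p M (t ∷ ts)) ws) ∎
    where
    open ≡-Reasoning
    ws : List (Vec ℕ (suc l))
    ws = words (suc l) (upTo (suc K))

  passages≡sum : ∀ {l} K p a M (ts : Vec ℕ l) → M ≤ K →
    passages p a M ts ≡ sum (List.map (passageTerm p a M ts) (words (suc l) (upTo (suc K))))
  passages≡sum {l} K p a M ts M≤K = begin
    conv M (λ c d → H a c * afterPassage (p + a + c) d ts)
      ≡⟨ conv≡sum K M M≤K _ ⟩
    sum (applyUpTo (λ c → (M C c) * (H a c * afterPassage (p + a + c) (M ∸ c) ts)) (suc K))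
      ≡⟨ sum-applyUpTo-cong expand (suc K) ⟩
    sum (applyUpTo (λ c → sum (List.map (λ s → passageTerm p a M ts (c ∷ s)) ws)) (suc K))
      ≡⟨ cong sum (map-upTo _ (suc K)) ⟨
    sum (List.map (λ c → sum (List.map (λ s → passageTerm p a M ts (c ∷ s)) ws)) (upTo (suc K)))
      ≡⟨ sum-words l (upTo (suc K)) (passageTerm p a M ts) ⟨
    sum (List.map (passageTerm p a M ts) (words (suc l) (upTo (suc K)))) ∎
    where
    open ≡-Reasoning
    ws : List (Vec ℕ l)
    ws = words l (upTo (suc K))
    split : ∀ c s → (M C c) * H a c * afterPassageTerm (p + a + c) (M ∸ c) ts s ≡ passageTerm p a M ts (c ∷ s)
    split c s = byTotal M (c + Vec.sum s ≟ M)
      where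
      b : ℕ
      b = ind (beyond? (p + a + c) ts s)
      regroup : ∀ x h i m q → x * h * (i * (1 * (m * q))) ≡ i * (1 * (x * m * (h * q)))
      regroup = solve-∀
      vanish : ∀ x i y z → x * (i * (0 * y)) ≡ i * (0 * z)
      vanish = solve-∀
      -- `M` is generalised so that matching on `refl` can replace it by the total.
      byTotal : ∀ M (d : Dec (c + Vec.sum s ≡ M)) →
        (M C c) * H a c * (b * (ind (Vec.sum s ≟ M ∸ c) * (multinomialℕ s * ∏H s))) ≡
        b * (ind d * (multinomialℕ (c ∷ s) * (H a c * ∏H s)))
      byTotal M (yes refl) = trans
        (cong (λ x → (M C c) * H a c * (b * (x * (multinomialℕ s * ∏H s))))
          (ind-yes (Vec.sum s ≟ M ∸ c) (sym (m+n∸m≡n c (Vec.sum s)))))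
        (regroup (M C c) (H a c) b (multinomialℕ s) (∏H s))
      byTotal M (no c+s≢M) with c ≤? M
      ... | yes c≤M = trans
        (cong (λ x → (M C c) * H a c * (b * (x * (multinomialℕ s * ∏H s))))
          (ind-no (Vec.sum s ≟ M ∸ c)
            (λ s≡M∸c → c+s≢M (trans (cong (c +_) s≡M∸c) (m+[n∸m]≡n c≤M)))))
        (vanish ((M C c) * H a c) b (multinomialℕ s * ∏H s) (multinomialℕ (c ∷ s) * (H a c * ∏H s)))
      -- Here `M ∸ c` truncates to 0 and may agree with `Vec.sum s` by accident, so the vanishing
      -- binomial coefficient is used instead.
      ... | no c≰M = trans
        (cong (λ x → x * H a c * (b * (ind (Vec.sum s ≟ M ∸ c) * (multinomialℕ s * ∏H s))))
          (k>n⇒nCk≡0 (≰⇒> c≰M)))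
        (sym (*-zeroʳ b))
    expand : ∀ c → (M C c) * (H a c * afterPassage (p + a + c) (M ∸ c) ts)
      ≡ sum (List.map (λ s → passageTerm p a M ts (c ∷ s)) ws)
    expand c = begin
      (M C c) * (H a c * afterPassage (p + a + c) (M ∸ c) ts)
        ≡⟨ *-assoc (M C c) _ _ ⟨
      (M C c) * H a c * afterPassage (p + a + c) (M ∸ c) ts
        ≡⟨ cong ((M C c) * H a c *_) (afterPassage≡sum K (p + a + c) (M ∸ c) ts (≤-trans (m∸n≤m M c) M≤K)) ⟩
      (M C c) * H a c * sum (List.map (afterPassageTerm (p + a + c) (M ∸ c) ts) ws)
        ≡⟨ *-distribˡ-sum-map ((M C c) * H a c) _ ws ⟩
      sum (List.map (λ s → (M C c) * H a c * afterPassageTerm (p + a + c) (M ∸ c) ts s) ws)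
        ≡⟨ sum-map-cong (split c) ws ⟩
      sum (List.map (λ s → passageTerm p a M ts (c ∷ s)) ws) ∎

-- Comparison with the rational formula.

-- The computation takes place among unnormalised fractions, where no common divisors are cancelled.
fromℕ-+ : ∀ a b → fromℕ (a + b) ≡ fromℕ a ℚ.+ fromℕ b
fromℕ-+ a b = ℚ.toℚᵘ-injective (begin
  toℚᵘ (fromℕ (a + b))               ≈⟨ ℚ.toℚᵘ-fromℚᵘ (mkℚᵘ (pos (a + b)) 0) ⟩
  mkℚᵘ (pos (a + b)) 0                  ≈⟨ *≡* (cong (ℤ._* 1ℤ) (sym (cong₂ ℤ._+_ (ℤ.*-identityʳ (pos a)) (ℤ.*-identityʳ (pos b))))) ⟩
  mkℚᵘ (pos a) 0 ℚᵘ.+ mkℚᵘ (pos b) 0     ≈⟨ ℚᵘ.+-cong (ℚ.toℚᵘ-fromℚᵘ (mkℚᵘ (pos a) 0)) (ℚ.toℚᵘ-fromℚᵘ (mkℚᵘ (pos b) 0)) ⟨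
  toℚᵘ (fromℕ a) ℚᵘ.+ toℚᵘ (fromℕ b) ≈⟨ ℚ.toℚᵘ-homo-+ (fromℕ a) (fromℕ b) ⟨
  toℚᵘ (fromℕ a ℚ.+ fromℕ b)         ∎)
  where open ℚᵘ.≃-Reasoning

fromℕ*/ : ∀ a b d .{{_ : NonZero d}} → fromℕ a ℚ.* (pos b ℚ./ d) ≡ pos (a * b) ℚ./ d
fromℕ*/ a b d@(suc d′) = ℚ.toℚᵘ-injective (begin
  toℚᵘ (fromℕ a ℚ.* (pos b ℚ./ d))         ≈⟨ ℚ.toℚᵘ-homo-* (fromℕ a) (pos b ℚ./ d) ⟩
  toℚᵘ (fromℕ a) ℚᵘ.* toℚᵘ (pos b ℚ./ d)   ≈⟨ ℚᵘ.*-cong (ℚ.toℚᵘ-fromℚᵘ (mkℚᵘ (pos a) 0)) (ℚ.toℚᵘ-fromℚᵘ (mkℚᵘ (pos b) d′)) ⟩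
  mkℚᵘ (pos a) 0 ℚᵘ.* mkℚᵘ (pos b) d′        ≈⟨ *≡* (cong₂ ℤ._*_ (sym (ℤ.pos-* a b)) (cong (λ x → pos (suc x)) (sym (+-identityʳ d′)))) ⟩
  mkℚᵘ (pos (a * b)) d′                    ≈⟨ ℚ.toℚᵘ-fromℚᵘ (mkℚᵘ (pos (a * b)) d′) ⟨
  toℚᵘ (pos (a * b) ℚ./ d)                 ∎)
  where open ℚᵘ.≃-Reasoning

fromℕ-* : ∀ a b → fromℕ (a * b) ≡ fromℕ a ℚ.* fromℕ b
fromℕ-* a b = sym (fromℕ*/ a b 1)

/≡fromℕ : ∀ x d y .{{_ : NonZero d}} → x ≡ y * d → pos x ℚ./ d ≡ fromℕ y
/≡fromℕ x d@(suc d′) y x≡yd = ℚ.fromℚᵘ-cong {mkℚᵘ (pos x) d′} {mkℚᵘ (pos y) 0}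
  (*≡* (trans (ℤ.*-identityʳ (pos x)) (trans (cong pos x≡yd) (ℤ.pos-* y d))))

-- For `s = 0` the power is the inverse of `suc e` and cancels against the factor in front. The
-- first block uses `e = n − m`, the others `e = 0`.
fromℕ*^ℤ≡H : ∀ e s c → c ≡ e + s → fromℕ (suc e) ℚ.* suc c ^ℤ (pos s ℤ.- 1ℤ) ≡ fromℕ (H (suc e) s)
fromℕ*^ℤ≡H e zero c refl = trans (fromℕ*/ (suc e) 1 (suc (e + 0) ^ 1) {{m^n≢0 (suc (e + 0)) 1}})
  (/≡fromℕ (suc e * 1) (suc (e + 0) ^ 1) 1 {{m^n≢0 (suc (e + 0)) 1}} (unit e))
  where
  unit : ∀ e → suc e * 1 ≡ 1 * (suc (e + 0) * 1)
  unit = solve-∀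
fromℕ*^ℤ≡H e (suc s) c refl = sym (fromℕ-* (suc e) (suc (e + suc s) ^ s))

-- Written as factorial quotients, the binomial coefficients telescope. This makes the division in
-- `multinomial` exact.
multinomialℕ*!≡sum! : ∀ {k} (s : Vec ℕ k) →
  Vec.sum s ! ≡ multinomialℕ s * product (List.map _! (toList s))
multinomialℕ*!≡sum! []      = refl
multinomialℕ*!≡sum! (c ∷ s) = begin
  (c + σ) !
    ≡⟨ m/n*n≡m {{c !* (c + σ ∸ c) !≢0}} (k![n∸k]!∣n! c≤c+σ) ⟨
  _
    ≡⟨ cong (_* (c ! * (c + σ ∸ c) !)) (nCk≡n!/k![n-k]! c≤c+σ) ⟨
  ((c + σ) C c) * (c ! * (c + σ ∸ c) !)
    ≡⟨ cong (λ x → ((c + σ) C c) * (c ! * x !)) (m+n∸m≡n c σ) ⟩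
  ((c + σ) C c) * (c ! * σ !)
    ≡⟨ cong (λ x → ((c + σ) C c) * (c ! * x)) (multinomialℕ*!≡sum! s) ⟩
  ((c + σ) C c) * (c ! * (multinomialℕ s * product (List.map _! (toList s))))
    ≡⟨ regroup ((c + σ) C c) (c !) (multinomialℕ s) _ ⟩
  ((c + σ) C c) * multinomialℕ s * (c ! * product (List.map _! (toList s))) ∎
  where
  open ≡-Reasoning
  σ : ℕ
  σ = Vec.sum s
  c≤c+σ : c ≤ c + σ
  c≤c+σ = m≤m+n c σ
  regroup : ∀ a b c d → a * (b * (c * d)) ≡ a * c * (b * d)
  regroup = solve-∀

multinomial≡fromℕ : ∀ {k} N (s : Vec ℕ k) → Vec.sum s ≡ N → multinomial N s ≡ fromℕ (multinomialℕ s)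
multinomial≡fromℕ N s refl = /≡fromℕ (N !) (product (List.map _! (toList s))) (multinomialℕ s) 
  {{product≢0 (map⁺ (ListAll.universal _!≢0 (toList s)))}} (multinomialℕ*!≡sum! s)

product≡∏H : ∀ {k} (s : Vec ℕ k) →
  productℚ (List.map (λ c → suc c ^ℤ (pos c ℤ.- 1ℤ)) (toList s)) ≡ fromℕ (∏H s)
product≡∏H []      = refl
product≡∏H (c ∷ s) = trans
  (cong₂ ℚ._*_ (trans (sym (ℚ.*-identityˡ (suc c ^ℤ (pos c ℤ.- 1ℤ)))) (fromℕ*^ℤ≡H 0 c c refl)) (product≡∏H s))
  (sym (fromℕ-* (H 1 c) (∏H s)))

-- The factor `n − m + 1` in front of the sum is given to the first block, whose power it completes
-- to `H`.
summand≡fromℕ : ∀ {l} m n c (s : Vec ℕ l) → Vec.sum (c ∷ s) ≡ m ∸ l →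
  fromℕ (suc (n ∸ m)) ℚ.* summand m n (c ∷ s)
    ≡ fromℕ (multinomialℕ (c ∷ s) * (H (suc (n ∸ m)) c * ∏H s))
summand≡fromℕ {l} m n c s sum≡ = begin
  e ℚ.* (x ℚ.* y ℚ.* z)
    ≡⟨ cong (e ℚ.*_) (ℚ.*-assoc x y z) ⟩
  e ℚ.* (x ℚ.* (y ℚ.* z))
    ≡⟨ ℚ-swap e x _ ⟩
  x ℚ.* (e ℚ.* (y ℚ.* z))
    ≡⟨ cong (x ℚ.*_) (ℚ.*-assoc e y z) ⟨
  x ℚ.* (e ℚ.* y ℚ.* z)
    ≡⟨ cong₂ ℚ._*_ (multinomial≡fromℕ (m ∸ l) (c ∷ s) sum≡)
         (cong₂ ℚ._*_ (fromℕ*^ℤ≡H (n ∸ m) c _ (+-comm c (n ∸ m))) (product≡∏H s)) ⟩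
  fromℕ (multinomialℕ (c ∷ s)) ℚ.* (fromℕ (H (suc (n ∸ m)) c) ℚ.* fromℕ (∏H s))
    ≡⟨ cong (fromℕ (multinomialℕ (c ∷ s)) ℚ.*_) (fromℕ-* (H (suc (n ∸ m)) c) (∏H s)) ⟨
  fromℕ (multinomialℕ (c ∷ s)) ℚ.* fromℕ (H (suc (n ∸ m)) c * ∏H s)
    ≡⟨ fromℕ-* (multinomialℕ (c ∷ s)) _ ⟨
  fromℕ (multinomialℕ (c ∷ s) * (H (suc (n ∸ m)) c * ∏H s)) ∎
  where
  open ≡-Reasoning
  e x y z : ℚ
  e = fromℕ (suc (n ∸ m))
  x = multinomial (m ∸ l) (c ∷ s)
  y = suc (c + (n ∸ m)) ^ℤ (pos c ℤ.- 1ℤ)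
  z = productℚ (List.map (λ sᵢ → suc sᵢ ^ℤ (pos sᵢ ℤ.- 1ℤ)) (toList s))

*-sumℚ-filter : ∀ {A : Set} {P : A → Set} (P? : Decidable P) e (f : A → ℚ) (g : A → ℕ) →
  (∀ x → P x → e ℚ.* f x ≡ fromℕ (g x)) → ∀ xs →
  e ℚ.* sumℚ (List.map f (filter P? xs)) ≡ fromℕ (sum (List.map (λ x → ind (P? x) * g x) xs))
*-sumℚ-filter P? e f g ef≡g []       = ℚ.*-zeroʳ e
*-sumℚ-filter P? e f g ef≡g (x ∷ xs) with P? x
... | no _   = *-sumℚ-filter P? e f g ef≡g xs
... | yes px = trans (ℚ.*-distribˡ-+ e (f x) _)
  (trans (cong₂ ℚ._+_ (trans (ef≡g x px) (cong fromℕ (sym (*-identityˡ (g x))))) (*-sumℚ-filter P? e f g ef≡g xs))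
    (sym (fromℕ-+ (1 * g x) _)))

-- Adding `n + (i + 1)` to both sides leaves natural numbers with the common summand `m`. The
-- inequality becomes strict because `v` counts spots from 0.
ℤ-bound⇔ℕ-bound : ∀ m n v i σ → m ≤ n →
  (pos m ℤ.- pos n ℤ.+ pos (suc v) ℤ.- pos (suc i) ℤ.≤ pos σ → v < suc (n ∸ m) + (i + σ)) ×
  (v < suc (n ∸ m) + (i + σ) → pos m ℤ.- pos n ℤ.+ pos (suc v) ℤ.- pos (suc i) ℤ.≤ pos σ)
ℤ-bound⇔ℕ-bound m n v i σ m≤n = to , from
  where
  open ≡-Reasoning
  lhs : pos m ℤ.- pos n ℤ.+ pos (suc v) ℤ.- pos (suc i) ℤ.+ (pos n ℤ.+ pos (suc i)) ≡ pos (m + suc v)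
  lhs = cancel (pos m) (pos n) (pos (suc v)) (pos (suc i))
    where
    cancel : ∀ a b c d → a ℤ.- b ℤ.+ c ℤ.- d ℤ.+ (b ℤ.+ d) ≡ a ℤ.+ c
    cancel = ℤ.solve-∀
  rhs : pos σ ℤ.+ (pos n ℤ.+ pos (suc i)) ≡ pos (m + (suc (n ∸ m) + (i + σ)))
  rhs = cong pos (begin
    σ + (n + suc i)                    ≡⟨ cong (λ x → σ + (x + suc i)) (m+[n∸m]≡n m≤n) ⟨
    σ + (m + (n ∸ m) + suc i)          ≡⟨ regroup σ m (n ∸ m) i ⟩
    m + (suc (n ∸ m) + (i + σ))        ∎)
    where
    regroup : ∀ σ m e i → σ + (m + e + suc i) ≡ m + (suc e + (i + σ))
    regroup = solve-∀
  to : pos m ℤ.- pos n ℤ.+ pos (suc v) ℤ.- pos (suc i) ℤ.≤ pos σ → v < suc (n ∸ m) + (i + σ)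
  to b = +-cancelˡ-≤ m _ _ (ℤ.drop‿+≤+
    (subst₂ ℤ._≤_ lhs rhs (ℤ.+-monoˡ-≤ (pos n ℤ.+ pos (suc i)) b)))
  from : v < suc (n ∸ m) + (i + σ) → pos m ℤ.- pos n ℤ.+ pos (suc v) ℤ.- pos (suc i) ℤ.≤ pos σ
  from b = subst₂ ℤ._≤_ (drop _) (drop (pos σ)) (ℤ.+-monoˡ-≤ (ℤ.- (pos n ℤ.+ pos (suc i)))
    (subst₂ ℤ._≤_ (sym lhs) (sym rhs) (ℤ.+≤+ (+-monoʳ-≤ m b))))
    where
    drop : ∀ x → x ℤ.+ (pos n ℤ.+ pos (suc i)) ℤ.+ ℤ.- (pos n ℤ.+ pos (suc i)) ≡ x
    drop x = cancel x (pos n ℤ.+ pos (suc i))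
      where
      cancel : ∀ x y → x ℤ.+ y ℤ.+ ℤ.- y ≡ x
      cancel = ℤ.solve-∀

-- The first passage, from height `n − m + 1` above its target, ends at `n − m + 1 + c`. From there
-- on, `Beyond` is the system of bounds that defines `S`.
abelSum≡passages : ∀ {l m n} (v : Vec (Fin n) l) → m ≤ n →
  abelSum m v ≡ fromℕ (passages 0 (suc (n ∸ m)) (m ∸ l) (Vec.map toℕ v))
abelSum≡passages {l} {m} {n} v m≤n = begin
  fromℕ (suc (n ∸ m)) ℚ.* sumℚ (List.map (summand m n) (filter (inS? m v) ws))
    ≡⟨ *-sumℚ-filter (inS? m v) (fromℕ (suc (n ∸ m))) (summand m n) term
         (λ { (c ∷ s) (_ , sum≡) → summand≡fromℕ m n c s sum≡ }) ws ⟩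
  fromℕ (sum (List.map (λ s → ind (inS? m v s) * term s) ws))
    ≡⟨ cong fromℕ (sum-map-cong (λ { (c ∷ s) →
         trans (cong (_* term (c ∷ s)) (indicator c s))
           (*-assoc (ind (beyond? (suc (n ∸ m) + c) (Vec.map toℕ v) s)) _ _) }) ws) ⟩
  fromℕ (sum (List.map (passageTerm 0 (suc (n ∸ m)) (m ∸ l) (Vec.map toℕ v)) ws))
    ≡⟨ cong fromℕ (passages≡sum (m ∸ l) 0 (suc (n ∸ m)) (m ∸ l) (Vec.map toℕ v) ≤-refl) ⟨
  fromℕ (passages 0 (suc (n ∸ m)) (m ∸ l) (Vec.map toℕ v)) ∎
  where
  open ≡-Reasoning
  ws : List (Vec ℕ (suc l))
  ws = words (suc l) (upTo (suc (m ∸ l)))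
  term : Vec ℕ (suc l) → ℕ
  term (c ∷ s) = multinomialℕ (c ∷ s) * (H (suc (n ∸ m)) c * ∏H s)
  indicator : ∀ c s → ind (inS? m v (c ∷ s)) ≡
    ind (beyond? (suc (n ∸ m) + c) (Vec.map toℕ v) s) * ind (Vec.sum (c ∷ s) ≟ m ∸ l)
  indicator c s = trans
    (ind-cong (inS? m v (c ∷ s)) (beyond? (suc (n ∸ m) + c) (Vec.map toℕ v) s ×-dec (Vec.sum (c ∷ s) ≟ m ∸ l))
      (λ (bounds , sum≡) → (λ i → subst₂ _<_ (sym (lookup-map i toℕ v)) (regroup (n ∸ m) (toℕ i) c _)
        (proj₁ (equiv i) (bounds i))) , sum≡)
      (λ (bounds , sum≡) → (λ i → proj₂ (equiv i)
        (subst₂ _<_ (lookup-map i toℕ v) (sym (regroup (n ∸ m) (toℕ i) c _)) (bounds i))) , sum≡))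
    (ind-× (beyond? (suc (n ∸ m) + c) (Vec.map toℕ v) s) (Vec.sum (c ∷ s) ≟ m ∸ l))
    where
    equiv : ∀ i → _
    equiv i = ℤ-bound⇔ℕ-bound m n (toℕ (lookup v i)) (toℕ i) (c + partialSum (toℕ i) s) m≤n
    regroup : ∀ e i c σ → suc e + (i + (c + σ)) ≡ suc e + c + (i + σ)
    regroup = solve-∀

-- The count as a number of walks.

increasing⇒AllPairs : ∀ {l n} (v : Vec (Fin n) l) → StrictlyIncreasing v → AllPairs _<_ (Vec.map toℕ v)
increasing⇒AllPairs []      inc = []
increasing⇒AllPairs (x ∷ v) inc =
  lookup⁻ (λ i → subst (toℕ x <_) (sym (lookup-map i toℕ v)) (inc {Fin.zero} {Fin.suc i} (s≤s z≤n)))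
    ∷ increasing⇒AllPairs v (λ {i} {j} i<j → inc {Fin.suc i} {Fin.suc j} (s≤s i<j))

#PF≡passages : ∀ {l m n} (l≤m : l ≤ m) → m ≤ n → (v : Vec (Fin n) l) → StrictlyIncreasing v →
  #PF l≤m v ≡ passages 0 (suc (n ∸ m)) (m ∸ l) (Vec.map toℕ v)
#PF≡passages {l} {m} {n} l≤m m≤n v inc = trans (#PF≡#good l≤m v)
  (#good≡passages 0 n (suc (n ∸ m)) (m ∸ l) (Vec.map toℕ v)
    (AllPairs.map <⇒≤ (increasing⇒AllPairs v inc))
    -- The starting height `n − (m − l) + 1` splits into `n − m + 1` and the `l` heights at which
    -- thresholds are tested.
    (cong suc (sym (trans (cong (n ∸ m +_) (m+[n∸m]≡n l≤m)) (m∸n+n≡m m≤n)))))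

-- The range in which the count is constant.

-- The walk descends by at most one per spot, so threshold `i` is tested no earlier than at
-- `p + a + i`. Thresholds below that pass every test, and their values do not matter.
passages-early : ∀ {l} p a M (ts us : Vec ℕ l) →
  (∀ i → lookup ts i < p + a + toℕ i) → (∀ i → lookup us i < p + a + toℕ i) →
  passages p a M ts ≡ passages p a M us
passages-early p a M []       []       ts< us< = refl
passages-early {suc l} p a M (t ∷ ts) (u ∷ us) ts< us< = conv-cong M λ c d _ → cong (H a c *_) (cong₂ _*_
  (trans (ind-yes (t <? p + a + c) (early c (ts< Fin.zero)))
    (sym (ind-yes (u <? p + a + c) (early c (us< Fin.zero)))))
  (passages-early (p + a + c) 1 d ts us (λ i → later c i (ts< (Fin.suc i))) (λ i → later c i (us< (Fin.suc i)))))
  where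
  early : ∀ {t} c → t < p + a + 0 → t < p + a + c
  early c t< = <-≤-trans t< (+-monoʳ-≤ (p + a) z≤n)
  later : ∀ {t} c (i : Fin l) → t < p + a + suc (toℕ i) → t < p + a + c + 1 + toℕ i
  later c i t< = <-≤-trans t< (≤-trans (+-monoˡ-≤ (suc (toℕ i)) (m≤m+n (p + a) c))
    (≤-reflexive (sym (+-assoc (p + a + c) 1 (toℕ i)))))

-- Strict decrease.

∑-mono-< : ∀ {n} {f g : Fin n → ℕ} → (∀ i → f i ≤ g i) → (i : Fin n) → f i < g i → ∑ f < ∑ g
∑-mono-< f≤g Fin.zero    f<g = +-mono-<-≤ f<g (∑-mono-≤ (f≤g ∘ Fin.suc))
∑-mono-< f≤g (Fin.suc i) f<g = +-mono-≤-< (f≤g Fin.zero) (∑-mono-< (f≤g ∘ Fin.suc) i f<g)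

∑words-mono-≤ : ∀ n M {f g} → (∀ w → f w ≤ g w) → ∑words n M f ≤ ∑words n M g
∑words-mono-≤ n zero    f≤g = f≤g []
∑words-mono-≤ n (suc M) f≤g = ∑-mono-≤ {n} λ x → ∑words-mono-≤ n M λ w → f≤g (toℕ x ∷ w)

∑words-mono-< : ∀ n M {f g} → (∀ w → f w ≤ g w) → ∀ w → ListAll.All (_< n) w → length w ≡ M →
  f w < g w → ∑words n M f < ∑words n M g
∑words-mono-< n zero    f≤g [] _ _ f<g = f<g
∑words-mono-< n (suc M) {f} {g} f≤g (x ∷ w) (x<n ∷ w<n) |w|≡M f<g = ∑-mono-< {n}
  (λ y → ∑words-mono-≤ n M λ u → f≤g (toℕ y ∷ u)) (Fin.fromℕ< x<n)
  (∑words-mono-< n M (λ u → f≤g (toℕ (Fin.fromℕ< x<n) ∷ u)) w w<n (suc-injective |w|≡M)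
    (subst (λ y → f (y ∷ w) < g (y ∷ w)) (sym (toℕ-fromℕ< x<n)) f<g))

-- At most one entry equals `k`. If the head is at least `k`, all later entries exceed `k`, and the
-- head accounts for the `suc`.
above-suc-distinct : ∀ {l} k (ts : Vec ℕ l) → AllPairs _<_ ts →
  above k (toList ts) ≤ suc (above (suc k) (toList ts))
above-suc-distinct k []       []             = z≤n
above-suc-distinct k (t ∷ ts) (t<ts ∷ inc) with k ≤? t
... | no k≰t rewrite ind-no (suc k ≤? t) (k≰t ∘ <⇒≤) = above-suc-distinct k ts inc
... | yes k≤t = s≤s (begin
  above k (toList ts)             ≤⟨ subst (above k (toList ts) ≤_) (length-toList ts) (above≤length k (toList ts)) ⟩
  _                               ≡⟨ above-all (suc k) ts (All.map (≤-<-trans k≤t) t<ts) ⟨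
  above (suc k) (toList ts)       ≤⟨ m≤n+m _ _ ⟩
  above (suc k) (toList (t ∷ ts)) ∎)
  where
  open ≤-Reasoning

above-distinct : ∀ {l} d k (ts : Vec ℕ l) → AllPairs _<_ ts →
  above k (toList ts) ≤ d + above (d + k) (toList ts)
above-distinct zero    k ts inc = ≤-refl
above-distinct (suc d) k ts inc = ≤-trans (above-distinct d k ts inc)
  (≤-trans (+-monoʳ-≤ d (above-suc-distinct (d + k) ts inc)) (≤-reflexive (+-suc d _)))

above-none : ∀ k xs → ListAll.All (_< k) xs → above k xs ≡ 0
above-none k []       []             = refl
above-none k (x ∷ xs) (x<k ∷ xs<k) = cong₂ _+_ (ind-no (k ≤? x) (<⇒≱ x<k)) (above-none k xs xs<k)

nums<n : ∀ {l n} (v : Vec (Fin n) l) → ListAll.All (_< n) (nums v)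
nums<n []      = []
nums<n (x ∷ v) = toℕ<n x ∷ nums<n v

above-increasing≤ : ∀ {l n} k (v : Vec (Fin n) l) → StrictlyIncreasing v → k ≤ n → above k (nums v) ≤ n ∸ k
above-increasing≤ {n = n} k v inc k≤n = begin
  above k (nums v)                   ≤⟨ above-distinct (n ∸ k) k (Vec.map toℕ v) (increasing⇒AllPairs v inc) ⟩
  n ∸ k + above (n ∸ k + k) (nums v) ≡⟨ cong (λ j → n ∸ k + above j (nums v)) (m∸n+n≡m k≤n) ⟩
  n ∸ k + above n (nums v)           ≡⟨ cong (n ∸ k +_) (above-none n (nums v) (nums<n v)) ⟩
  n ∸ k + 0                          ≡⟨ +-identityʳ _ ⟩
  n ∸ k                              ∎
  where open ≤-Reasoning

-- All entries after the `i`th exceed it; the others number `suc (toℕ i)`.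
above-lookup : ∀ {l n} (v : Vec (Fin n) l) → StrictlyIncreasing v → (i : Fin l) →
  l ≤ suc (toℕ i) + above (suc (toℕ (lookup v i))) (nums v)
above-lookup {suc l} (x ∷ v) inc Fin.zero = s≤s (begin
  l                                   ≡⟨ above-all (suc (toℕ x)) (Vec.map toℕ v) (AllPairs.head (increasing⇒AllPairs (x ∷ v) inc)) ⟨
  above (suc (toℕ x)) (nums v)        ≤⟨ m≤n+m _ _ ⟩
  above (suc (toℕ x)) (nums (x ∷ v))  ∎)
  where open ≤-Reasoning
above-lookup {suc l} (x ∷ v) inc (Fin.suc i) = s≤s (≤-trans
  (above-lookup v (λ {i} {j} i<j → inc {Fin.suc i} {Fin.suc j} (s≤s i<j)) i)
  (+-monoʳ-≤ (suc (toℕ i)) (m≤n+m _ _)))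

above-mono : ∀ {l n} k (v v′ : Vec (Fin n) l) → (∀ i → lookup v i Fin.≤ lookup v′ i) →
  above k (nums v) ≤ above k (nums v′)
above-mono k []      []        v≤v′ = z≤n
above-mono k (x ∷ v) (x′ ∷ v′) v≤v′ = +-mono-≤
  (ind-mono (k ≤? toℕ x) (k ≤? toℕ x′) (λ k≤x → ≤-trans k≤x (v≤v′ Fin.zero)))
  (above-mono k v v′ (v≤v′ ∘ Fin.suc))

above-mono-< : ∀ {l n} k (v v′ : Vec (Fin n) l) → (∀ i → lookup v i Fin.≤ lookup v′ i) → (i : Fin l) →
  toℕ (lookup v i) < k → k ≤ toℕ (lookup v′ i) → above k (nums v) < above k (nums v′)
above-mono-< k (x ∷ v) (x′ ∷ v′) v≤v′ Fin.zero x<k k≤x′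
  rewrite ind-no (k ≤? toℕ x) (<⇒≱ x<k) | ind-yes (k ≤? toℕ x′) k≤x′ =
  s≤s (above-mono k v v′ (v≤v′ ∘ Fin.suc))
above-mono-< k (x ∷ v) (x′ ∷ v′) v≤v′ (Fin.suc i) x<k k≤x′ = +-mono-≤-<
  (ind-mono (k ≤? toℕ x) (k ≤? toℕ x′) (λ k≤x → ≤-trans k≤x (v≤v′ Fin.zero)))
  (above-mono-< k v v′ (v≤v′ ∘ Fin.suc) i x<k k≤x′)

above-replicate : ∀ A k x → k ≤ x → above k (replicate A x) ≡ A
above-replicate zero    k x k≤x = refl
above-replicate (suc A) k x k≤x = cong₂ _+_ (ind-yes (k ≤? x) k≤x) (above-replicate A k x k≤x)

-- The word consists of entries suc y, as many as fit at or beyond spot suc y next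
-- to v, and of zeros: it completes v, but nothing that has more entries there.
module Tight {l m n} (l≤m : l ≤ m) (m≤n : m ≤ n) (v : Vec (Fin n) l) (inc : StrictlyIncreasing v)
  (y : ℕ) (y<n : suc y < n) (room : n ∸ suc y ∸ above (suc y) (nums v) ≤ m ∸ l) where

  A : ℕ
  A = n ∸ suc y ∸ above (suc y) (nums v)

  word : List ℕ
  word = replicate A (suc y) ++ replicate (m ∸ l ∸ A) 0

  length-word : length word ≡ m ∸ l
  length-word = begin
    length word                                                      ≡⟨ length-++ (replicate A (suc y)) ⟩
    length (replicate A (suc y)) + length (replicate (m ∸ l ∸ A) 0)  ≡⟨ cong₂ _+_ (length-replicate A) (length-replicate (m ∸ l ∸ A)) ⟩
    A + (m ∸ l ∸ A)                                                  ≡⟨ m+[n∸m]≡n room ⟩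
    m ∸ l                                                            ∎
    where open ≡-Reasoning

  word<n : ListAll.All (_< n) word
  word<n = ++⁺ (replicate⁺ A y<n) (replicate⁺ (m ∸ l ∸ A) (≤-trans (s≤s z≤n) y<n))

  above-word : ∀ k → suc k ≤ suc y → above (suc k) word ≡ A
  above-word k k≤y = begin
    above (suc k) word
      ≡⟨ above-++ (suc k) (replicate A (suc y)) _ ⟩
    above (suc k) (replicate A (suc y)) + above (suc k) (replicate (m ∸ l ∸ A) 0)
      ≡⟨ cong₂ _+_ (above-replicate A (suc k) (suc y) k≤y)
           (above-none (suc k) (replicate (m ∸ l ∸ A) 0) (replicate⁺ (m ∸ l ∸ A) (s≤s z≤n))) ⟩
    A + 0
      ≡⟨ +-identityʳ A ⟩
    A ∎
    where open ≡-Reasoning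

  A+above : A + above (suc y) (nums v) ≡ n ∸ suc y
  A+above = m∸n+n≡m (above-increasing≤ (suc y) v inc (<⇒≤ y<n))

  good : Good 0 n (Vec.map toℕ v) word
  good Fin.zero = begin
    above 0 word + above 0 (nums v)  ≤⟨ +-mono-≤ (above≤length 0 word) (above≤length 0 (nums v)) ⟩
    length word + length (nums v)    ≡⟨ cong₂ _+_ length-word (length-toList (Vec.map toℕ v)) ⟩
    m ∸ l + l                        ≡⟨ m∸n+n≡m l≤m ⟩
    m                                ≤⟨ m≤n ⟩
    n                                ∎
    where open ≤-Reasoning
  good (Fin.suc k) with toℕ k ≤? y
  -- The condition holds with equality at `suc y`. Going back to `suc k` adds `y − k` spots and, the
  -- entries of `v` being distinct, at most as many entries of `v`.
  ... | yes k≤y = begin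
    above (suc (toℕ k)) word + above (suc (toℕ k)) (nums v)
      ≡⟨ cong (_+ above (suc (toℕ k)) (nums v)) (above-word (toℕ k) (s≤s k≤y)) ⟩
    A + above (suc (toℕ k)) (nums v)
      ≤⟨ +-monoʳ-≤ A (above-distinct (y ∸ toℕ k) (suc (toℕ k)) (Vec.map toℕ v) (increasing⇒AllPairs v inc)) ⟩
    A + (y ∸ toℕ k + above (y ∸ toℕ k + suc (toℕ k)) (nums v))
      ≡⟨ cong (λ j → A + (y ∸ toℕ k + above j (nums v))) (trans (+-suc (y ∸ toℕ k) (toℕ k)) (cong suc (m∸n+n≡m k≤y))) ⟩
    A + (y ∸ toℕ k + above (suc y) (nums v))
      ≡⟨ swap A (y ∸ toℕ k) _ ⟩
    y ∸ toℕ k + (A + above (suc y) (nums v))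
      ≡⟨ cong (y ∸ toℕ k +_) A+above ⟩
    y ∸ toℕ k + (n ∸ suc y)
      ≡⟨ +-comm (suc y ∸ suc (toℕ k)) (n ∸ suc y) ⟩
    n ∸ suc y + (suc y ∸ suc (toℕ k))
      ≡⟨ +-∸-assoc (n ∸ suc y) (s≤s k≤y) ⟨
    n ∸ suc y + suc y ∸ suc (toℕ k)
      ≡⟨ cong (_∸ suc (toℕ k)) (m∸n+n≡m (<⇒≤ y<n)) ⟩
    n ∸ suc (toℕ k) ∎
    where
    open ≤-Reasoning
    swap : ∀ a b c → a + (b + c) ≡ b + (a + c)
    swap = solve-∀
  -- No entry of the word lies this far, and the distinct entries of `v` fit by themselves.
  ... | no k≰y = begin
    above (suc (toℕ k)) word + above (suc (toℕ k)) (nums v)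
      ≡⟨ cong (_+ above (suc (toℕ k)) (nums v)) (above-none (suc (toℕ k)) word
           (++⁺ (replicate⁺ A (s≤s (≰⇒> k≰y))) (replicate⁺ (m ∸ l ∸ A) (s≤s z≤n)))) ⟩
    above (suc (toℕ k)) (nums v)
      ≤⟨ above-increasing≤ (suc (toℕ k)) v inc (toℕ<n k) ⟩
    n ∸ suc (toℕ k) ∎
    where open ≤-Reasoning

  -- The condition at `suc y` is already an equality for `v`, so a further entry there breaks it.
  ¬good : ∀ (v′ : Vec (Fin n) l) → above (suc y) (nums v) < above (suc y) (nums v′) →
    ¬ Good 0 n (Vec.map toℕ v′) word
  ¬good v′ more good′ = <⇒≱ overfull
    (subst (λ k → above k word + above k (nums v′) ≤ n ∸ k) (toℕ-fromℕ< (<⇒≤ (s≤s y<n))) (good′ (Fin.fromℕ< (<⇒≤ (s≤s y<n)))))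
    where
    open ≤-Reasoning
    overfull : n ∸ suc y < above (suc y) word + above (suc y) (nums v′)
    overfull = begin-strict
      n ∸ suc y                                     ≡⟨ A+above ⟨
      A + above (suc y) (nums v)                    <⟨ +-monoʳ-< A more ⟩
      A + above (suc y) (nums v′)                   ≡⟨ cong (_+ above (suc y) (nums v′)) (above-word y ≤-refl) ⟨
      above (suc y) word + above (suc y) (nums v′)  ∎

-- Raising entries only tightens the criterion, so every word that completes `v′` completes `v`. The
-- word of `Tight` for `y = vᵢ` is one that is lost.
#PF-decreasing : ∀ {l m n} (l≤m : l ≤ m) → m ≤ n → (v v′ : Vec (Fin n) l) →
  StrictlyIncreasing v → (∀ j → lookup v j Fin.≤ lookup v′ j) →
  (i : Fin l) → n ∸ m + toℕ i ≤ toℕ (lookup v i) → lookup v i Fin.< lookup v′ i →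
  #PF l≤m v′ < #PF l≤m v
#PF-decreasing {l} {m} {n} l≤m m≤n v v′ inc v≤v′ i late vᵢ<v′ᵢ =
  subst₂ _<_ (sym (#PF≡#good l≤m v′)) (sym (#PF≡#good l≤m v))
    (∑words-mono-< n (m ∸ l)
      (λ w → ind-mono (good? 0 n (Vec.map toℕ v′) w) (good? 0 n (Vec.map toℕ v) w)
        λ good′ k → ≤-trans (+-monoʳ-≤ (above (toℕ k) w) (above-mono (toℕ k) v v′ v≤v′)) (good′ k))
      word word<n length-word
      (subst₂ _<_
        (sym (ind-no (good? 0 n (Vec.map toℕ v′) word) (¬good v′ (above-mono-< (suc x) v v′ v≤v′ i ≤-refl vᵢ<v′ᵢ))))
        (sym (ind-yes (good? 0 n (Vec.map toℕ v) word) good)) (s≤s z≤n)))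
  where
  x : ℕ
  x = toℕ (lookup v i)
  above-v : ℕ
  above-v = above (suc x) (nums v)
  -- This is where `late` enters: at most `i + 1` entries of `v` are not beyond `vᵢ`, hence the
  -- spots beyond `vᵢ` left over by `v` number at most `m − l`.
  room : n ∸ suc x ∸ above-v ≤ m ∸ l
  room = m≤n+o⇒m∸n≤o (n ∸ suc x) above-v (m≤n+o⇒m∸n≤o n (suc x) (begin
    n                                  ≡⟨ m∸n+n≡m m≤n ⟨
    n ∸ m + m                          ≡⟨ cong (n ∸ m +_) (m∸n+n≡m l≤m) ⟨
    n ∸ m + (m ∸ l + l)                ≤⟨ +-monoʳ-≤ (n ∸ m) (+-monoʳ-≤ (m ∸ l) (above-lookup v inc i)) ⟩
    n ∸ m + (m ∸ l + (suc (toℕ i) + above-v))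
      ≡⟨ regroup (n ∸ m) (m ∸ l) (toℕ i) above-v ⟩
    suc (n ∸ m + toℕ i) + (above-v + (m ∸ l))
      ≤⟨ +-monoˡ-≤ (above-v + (m ∸ l)) (s≤s late) ⟩
    suc x + (above-v + (m ∸ l))        ∎))
    where
    open ≤-Reasoning
    regroup : ∀ a b i c → a + (b + (suc i + c)) ≡ suc (a + i) + (c + b)
    regroup = solve-∀
  open Tight l≤m m≤n v inc x (≤-<-trans vᵢ<v′ᵢ (toℕ<n (lookup v′ i))) room

theorem2p5 : (l m n : ℕ) → 1 ≤ l → (l≤m : l ≤ m) → m ≤ n →
    ((v : Vec (Fin n) l) → StrictlyIncreasing v →
    fromℕ (#PF l≤m v) ≡ abelSum m v)
    ×
    ((v v′ : Vec (Fin n) l) → StrictlyIncreasing v → StrictlyIncreasing v′ →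
    (∀ i → num (lookup v i) ≤ (n ∸ m) + num i) →
    (∀ i → num (lookup v′ i) ≤ (n ∸ m) + num i) →
    #PF l≤m v ≡ #PF l≤m v′)
    ×
    ((v v′ : Vec (Fin n) l) → StrictlyIncreasing v → StrictlyIncreasing v′ →
    (i : Fin l) → (∀ j → j ≢ i → lookup v j ≡ lookup v′ j) →
    (n ∸ m) + num i ≤ num (lookup v i) →
    num (lookup v i) < num (lookup v′ i) →
    #PF l≤m v′ < #PF l≤m v)
theorem2p5 l m n _ l≤m m≤n = formula , constant , decreasing
  where
  formula : (v : Vec (Fin n) l) → StrictlyIncreasing v → fromℕ (#PF l≤m v) ≡ abelSum m v
  formula v inc = trans (cong fromℕ (#PF≡passages l≤m m≤n v inc)) (sym (abelSum≡passages v m≤n))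
  constant : (v v′ : Vec (Fin n) l) → StrictlyIncreasing v → StrictlyIncreasing v′ →
    (∀ i → num (lookup v i) ≤ (n ∸ m) + num i) → (∀ i → num (lookup v′ i) ≤ (n ∸ m) + num i) →
    #PF l≤m v ≡ #PF l≤m v′
  constant v v′ inc inc′ early early′ = trans (#PF≡passages l≤m m≤n v inc)
    (trans (passages-early 0 (suc (n ∸ m)) (m ∸ l) (Vec.map toℕ v) (Vec.map toℕ v′) (bound v early) (bound v′ early′))
      (sym (#PF≡passages l≤m m≤n v′ inc′)))
    where
    -- Passing from `num` to `toℕ` lowers the left side by one, which the strict inequality absorbs;
    -- the right side is the bound of `passages-early` for `p = 0` and `a = n − m + 1`.
    bound : (u : Vec (Fin n) l) → (∀ i → num (lookup u i) ≤ (n ∸ m) + num i) →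
      ∀ i → lookup (Vec.map toℕ u) i < suc (n ∸ m) + toℕ i
    bound u early i = subst₂ _<_ (sym (lookup-map i toℕ u)) (+-suc (n ∸ m) (toℕ i)) (early i)
  decreasing : (v v′ : Vec (Fin n) l) → StrictlyIncreasing v → StrictlyIncreasing v′ →
    (i : Fin l) → (∀ j → j ≢ i → lookup v j ≡ lookup v′ j) →
    (n ∸ m) + num i ≤ num (lookup v i) → num (lookup v i) < num (lookup v′ i) →
    #PF l≤m v′ < #PF l≤m v
  decreasing v v′ inc _ i same late vᵢ<v′ᵢ = #PF-decreasing l≤m m≤n v v′ inc v≤v′ i
    (s≤s⁻¹ (≤-trans (≤-reflexive (sym (+-suc (n ∸ m) (toℕ i)))) late)) (s≤s⁻¹ vᵢ<v′ᵢ)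
    where
    v≤v′ : ∀ j → lookup v j Fin.≤ lookup v′ j
    v≤v′ j with j Fin.≟ i
    ... | yes refl = <⇒≤ (s≤s⁻¹ vᵢ<v′ᵢ)
    ... | no j≢i   = ≤-reflexive (cong toℕ (same j j≢i))
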